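{- Consider the online time-critical task scheduling with calibration problem with unit processing time jobs, activation time $\lambda$ (a nonnegative integer) and calibrated length $T$. There exists a deterministic online algorithm for this problem with competitive ratio $3(e+1)\lambda+3e+7$. In particular, for the special case $\lambda=0$ there exists a deterministic online algorithm with competitive ratio $3e+7\ (\approx 15.16)$.
   Context: Problem (online time-critical task scheduling with calibration, unit processing times): There is an unlimited number of identical machines. Time is discrete (integer time steps). A calibration started at integer time $t$ occupies a machine during $[t,t+\lambda+T)$: the interval $[t,t+\lambda)$ is the activation (calibrating) interval, and $[t+\lambda,t+\lambda+T)$ is the calibrated interval. A machine can process jobs only while calibrated, and processes at most one job at a time. Each job $j$ has integer release time $r_j$, processing time $p_j=1$, and integer deadline $d_j$, with $d_j-r_j\ge 1+\lambda$. A job scheduled at integer time $t$ occupies one calibrated slot $[t,t+1)$ of some calibration and is feasibly scheduled iff $r_j\le t$ and $t+1\le d_j$. Jobs arrive online: the algorithm learns job $j$ only at time $r_j$; at each time step it may start calibrations at the current time and schedule released jobs at the current time (decisions cannot be made retroactively). The objective is to minimize the total number of calibrations while feasibly scheduling all jobs. An online algorithm ALG is $c$-competitive if there is a constant $a$ such that for every instance $Ins$, $ALG(Ins)\le c\cdot OPT(Ins)+a$, where $ALG(Ins)$ is the number of calibrations used by the algorithm and $OPT(Ins)$ the minimum possible number of calibrations for $Ins$. -}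

module Defs where

open import Data.Nat.Base using (ℕ; zero; suc; _+_; _*_; _∸_; _≤_; _≤ᵇ_; _<ᵇ_; _≡ᵇ_)
open import Data.Bool.Base using (Bool; true; false; if_then_else_; _∧_)
open import Data.List.Base using (List; []; _∷_; length; lookup)
open import Data.List.Relation.Unary.All using (All)
open import Data.Fin.Base using (Fin; zero; suc)
open import Data.Product.Base using (_×_; Σ; ∃; _,_; proj₁; proj₂)
open import Relation.Binary.PropositionalEquality using (_≡_)

-- Euler's number e, handled exactly via its series.
-- eNum n = n! * (Σ_{k=0}^{n} 1/k!)   (an integer)

fact : ℕ → ℕ
fact zero    = 1
fact (suc n) = suc n * fact n

eNum : ℕ → ℕ
eNum zero    = 1
eNum (suc n) = suc n * eNum n + 1

-- "x ≤ m · e" for naturals x, m.  With S_n = eNum n / n!, the numbers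
-- U_n = S_n + 1/(n!·n) (n ≥ 1) strictly decrease to e and e < U_n, so
-- x ≤ m·e  iff  x ≤ m·U_n for every n ≥ 1, i.e.
-- x·n!·n ≤ m·(n·eNum n + 1) for every n ≥ 1.
_≤·e_ : ℕ → ℕ → Set
x ≤·e m = ∀ n → x * (fact (suc n) * suc n) ≤ m * (suc n * eNum (suc n) + 1)

-- "A ≤ (3(e+1)λ + 3e + 7)·k + a"
--   ⟺  A ∸ ((3λ+7)·k + a) ≤ ((3λ+3)·k)·e
CompBound : (act A k a : ℕ) → Set
CompBound act A k a = (A ∸ ((3 * act + 7) * k + a)) ≤·e ((3 * act + 3) * k)

record Job : Set where
  constructor job
  field
    rel : ℕ
    dl  : ℕ
open Job public

ValidJob : (act : ℕ) → Job → Set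
ValidJob act j = rel j + (1 + act) ≤ dl j

Instance : Set
Instance = List Job

ValidInstance : ℕ → Instance → Set
ValidInstance act I = All (ValidJob act) I

sumTo : (ℕ → ℕ) → ℕ → ℕ
sumTo f zero    = 0
sumTo f (suc n) = sumTo f n + f n

#true : (n : ℕ) → (Fin n → Bool) → ℕ
#true zero    f = 0
#true (suc n) f = (if f zero then 1 else 0) + #true n (λ i → f (suc i))

calibratedAt : (act T s t : ℕ) → Bool
calibratedAt act T s t = (s + act ≤ᵇ t) ∧ (t <ᵇ s + act + T)

-- Online algorithms.
-- At time t the algorithm sees exactly the jobs released so far
-- (those with r_j ≤ t, in input order). It outputs the number of
-- calibrations to start at time t, and a list of booleans marking which
-- of the visible jobs to process at time t.  (Deterministic; its own past
-- decisions can be recomputed from earlier views, which are sublists of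
-- the current view.)

released : ℕ → Job → Bool
released t j = rel j ≤ᵇ t

view : ℕ → Instance → List Job
view t []       = []
view t (j ∷ js) = if released t j then j ∷ view t js else view t js

Decision : Set
Decision = ℕ × List Bool

OnlineAlg : Set
OnlineAlg = ℕ → List Job → Decision

headOr : List Bool → Bool
headOr []      = false
headOr (b ∷ _) = b

tailL : List Bool → List Bool
tailL []       = []
tailL (_ ∷ bs) = bs

-- interpret marks on the view as marks on positions of the full instance
marked : (t : ℕ) (I : Instance) → List Bool → Fin (length I) → Bool
marked t (j ∷ js) bs zero    = if released t j then headOr bs else false
marked t (j ∷ js) bs (suc i) = marked t js (if released t j then tailL bs else bs) i

algCal : OnlineAlg → Instance → ℕ → ℕ
algCal alg I t = proj₁ (alg t (view t I))

algRuns : OnlineAlg → (I : Instance) → ℕ → Fin (length I) → Bool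
algRuns alg I t = marked t I (proj₂ (alg t (view t I)))

-- Unlimited identical machines: each calibration can be put on its own
-- machine, so a schedule is feasible iff at every time t the number of jobs
-- processed at t is at most the number of calibrations calibrated at t.
algActive : (act T : ℕ) → OnlineAlg → Instance → ℕ → ℕ
algActive act T alg I t =
  sumTo (λ s → if calibratedAt act T s t then algCal alg I s else 0) (suc t)

AlgFeasible : (act T : ℕ) → OnlineAlg → Instance → Set
AlgFeasible act T alg I =
  (∀ (i : Fin (length I)) →
     Σ ℕ (λ t → (algRuns alg I t i ≡ true)
              × (rel (lookup I i) ≤ t)
              × (t + 1 ≤ dl (lookup I i))
              × (∀ t′ → algRuns alg I t′ i ≡ true → t′ ≡ t)))
  × (∀ t → #true (length I) (algRuns alg I t) ≤ algActive act T alg I t)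

-- Offline schedules: a list of calibration start times and a time slot for
-- each job. The number of calibrations is the length of the list.

countList : (ℕ → Bool) → List ℕ → ℕ
countList p []       = 0
countList p (s ∷ ss) = (if p s then 1 else 0) + countList p ss

OffFeasible : (act T : ℕ) (I : Instance) → List ℕ → (Fin (length I) → ℕ) → Set
OffFeasible act T I cals time =
  (∀ (i : Fin (length I)) →
       (rel (lookup I i) ≤ time i)
     × (time i + 1 ≤ dl (lookup I i)))
  × (∀ t → #true (length I) (λ i → time i ≡ᵇ t)
             ≤ countList (λ s → calibratedAt act T s t) cals)

{-# OPTIONS --safe #-}

-- Plan act steps ahead: a job then has the window [rel, dl - act), calibrations
-- are usable at once, and any schedule for the original windows becomes one for
-- the shrunk windows with act + 1 copies of each calibration.  Let T be the
-- length of a calibration and h = ⌊T/2⌋.  All jobs are run earliest deadline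
-- first on the open calibrations.
--
-- Windows of length ≤ h: at time t keep 4 times the maximal density of known
-- jobs in intervals [t - u, t + u), u ≤ h, open.  A job collects enough credit
-- during the first half of the time to any later deadline, which gives Hall's
-- condition.  Openings paid at times at least T apart see every optimal
-- calibration at most twice, so this costs 8 (act + 1) OPT.
--
-- Windows of length ≥ H = h + 1: use only the first H slots of a calibration,
-- and open new ones when the pending jobs due within H steps exceed the capacity
-- left.  Between two openings the wasted capacity is at most one calibration,
-- and if any is wasted, then the job that triggers the next opening was released
-- after the previous one, so an optimal calibration is close.  This costs
-- (act + 7) OPT + 1.
module Submission where

open import Defs
open import Data.Bool.Base using (Bool; true; false; if_then_else_; _∧_; not; T)
open import Data.Bool.Properties using (T-∧; T-≡)
open import Data.Nat.Base
open import Data.Nat.Properties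
open import Data.Nat.DivMod using (_/_; _%_; m/n*n≤m; m/n*n≡m; /-monoʳ-≤; m<n*o⇒m/o<n; m≡m%n+[m/n]*n; m%n<n)
open import Data.Nat.Divisibility using (∣-trans; m∣m*n; m≤n⇒m!∣n!)
open import Data.List.Properties using (length-++; length-map)
open import Data.Nat.Tactic.RingSolver using (solve-∀)
open import Data.List.Base using (List; []; _∷_; length; lookup; map; _++_)
open import Data.List.Relation.Unary.All as All using (All; []; _∷_)
open import Data.List.Membership.Propositional using (_∈_)
open import Data.List.Membership.Propositional.Properties using (∈-lookup)
open import Data.List.Relation.Unary.Any using (here; there)
open import Data.Fin.Base using (Fin; zero; suc)
open import Data.Product.Base using (Σ; _×_; _,_; proj₁; proj₂; ∃)
open import Data.Sum.Base using (_⊎_; inj₁; inj₂)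
open import Data.Empty using (⊥-elim)
open import Relation.Nullary using (¬_; yes; no; contradiction)
open import Relation.Binary.PropositionalEquality
open import Function.Base using (_∘_)
open import Function.Bundles using (Equivalence)

-- An algorithm is a function of the current view and carries no state, so its past is recomputed at
-- every step: the openings are a causal fixed point over the arrival counts, and which job runs is
-- read off from queue lengths. Arrival counts up to the current time are the same in the view and
-- in the whole instance, which makes the plan online.
--
-- The two families of openings are planned separately but serve one queue. For this, feasibility is
-- carried as Hall's condition for each deadline, which is additive in arrivals and capacity.
--
-- The threshold ⌊T/2⌋ suits both costs: 2h ≤ T confines the times at which an optimal calibration
-- can justify short openings to fewer than 2T steps, and T ≤ 2H means that cutting long
-- calibrations to H slots loses at most a factor 2. The cut pays off because everything open at t
-- then ends by t + H, while no long job released after t is due by t + H, so total capacity alone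
-- decides feasibility.
--
-- The costs add up to (9λ + 15) OPT + 1, where λ is `act`, and e ≥ 8/3 gives 3(e + 1)λ + 3e + 7 ≥
-- 11λ + 15.

≤-linear : ∀ {a b l r} e → a ≤ b → l + b + e ≡ a + r → l ≤ r
-- Callers take for `a ≤ b` a sum of known inequalities and for `e` the slack, so that only a
-- polynomial identity is left to the ring solver.
≤-linear {a} {b} {l} {r} e a≤b eq = +-cancelˡ-≤ b l r (begin
  b + l      ≡⟨ +-comm b l ⟩
  l + b      ≤⟨ m≤m+n (l + b) e ⟩
  l + b + e  ≡⟨ eq ⟩
  a + r      ≤⟨ +-monoˡ-≤ r a≤b ⟩
  b + r      ∎)
  where open ≤-Reasoning

+-interchange : ∀ a b c d → a + b + (c + d) ≡ a + c + (b + d)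
+-interchange = solve-∀

⌈n/2⌉≤1+⌊n/2⌋ : ∀ n → ⌈ n /2⌉ ≤ suc ⌊ n /2⌋
⌈n/2⌉≤1+⌊n/2⌋ n = ⌊n/2⌋-mono (n≤1+n (suc n))

-- Indicators

𝟙 : Bool → ℕ
𝟙 b = if b then 1 else 0

𝟙≤1 : ∀ b → 𝟙 b ≤ 1
𝟙≤1 true  = ≤-refl
𝟙≤1 false = z≤n

𝟙-mono : ∀ {b c} → (T b → T c) → 𝟙 b ≤ 𝟙 c
𝟙-mono {false}         f = z≤n
𝟙-mono {true}  {true}  f = ≤-refl
𝟙-mono {true}  {false} f = ⊥-elim (f _)

𝟙-true : ∀ {b} → T b → 𝟙 b ≡ 1
𝟙-true {true} _ = refl

𝟙-false : ∀ {b} → ¬ T b → 𝟙 b ≡ 0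
𝟙-false {false} _  = refl
𝟙-false {true}  ¬b = ⊥-elim (¬b _)

T-∧-intro : ∀ {a b} → T a → T b → T (a ∧ b)
T-∧-intro p q = Equivalence.from T-∧ (p , q)

T-∧-elim : ∀ {a b} → T (a ∧ b) → T a × T b
T-∧-elim = Equivalence.to T-∧

-- Sums over initial segments

sumTo-cong : ∀ {f g} n → (∀ i → i < n → f i ≡ g i) → sumTo f n ≡ sumTo g n
sumTo-cong zero    eq = refl
sumTo-cong (suc n) eq = cong₂ _+_ (sumTo-cong n λ i i<n → eq i (m<n⇒m<1+n i<n)) (eq n ≤-refl)

sumTo-mono : ∀ {f g} n → (∀ i → i < n → f i ≤ g i) → sumTo f n ≤ sumTo g n
sumTo-mono zero    le = z≤n
sumTo-mono (suc n) le = +-mono-≤ (sumTo-mono n λ i i<n → le i (m<n⇒m<1+n i<n)) (le n ≤-refl)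

sumTo-monoʳ : ∀ f {m n} → m ≤ n → sumTo f m ≤ sumTo f n
sumTo-monoʳ f {m} {n} m≤n with m≤n⇒m<n∨m≡n m≤n
sumTo-monoʳ f {m} {suc n} _ | inj₁ (s≤s m≤n) = ≤-trans (sumTo-monoʳ f m≤n) (m≤m+n _ _)
... | inj₂ refl = ≤-refl

sumTo-zero : ∀ n → sumTo (λ _ → 0) n ≡ 0
sumTo-zero zero    = refl
sumTo-zero (suc n) = trans (+-identityʳ _) (sumTo-zero n)

sumTo-+ : ∀ f g n → sumTo (λ i → f i + g i) n ≡ sumTo f n + sumTo g n
sumTo-+ f g zero    = refl
sumTo-+ f g (suc n) = trans (cong (_+ (f n + g n)) (sumTo-+ f g n)) (+-interchange (sumTo f n) (sumTo g n) (f n) (g n))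

sumTo-*ˡ : ∀ c f n → sumTo (λ i → c * f i) n ≡ c * sumTo f n
sumTo-*ˡ c f zero    = sym (*-zeroʳ c)
sumTo-*ˡ c f (suc n) = trans (cong (_+ c * f n) (sumTo-*ˡ c f n)) (sym (*-distribˡ-+ c (sumTo f n) (f n)))

sumTo-split : ∀ f k m → sumTo f (k + m) ≡ sumTo f k + sumTo (λ i → f (k + i)) m
sumTo-split f k zero    = trans (cong (sumTo f) (+-identityʳ k)) (sym (+-identityʳ _))
sumTo-split f k (suc m) = trans (cong (sumTo f) (+-suc k m))
  (trans (cong (_+ f (k + m)) (sumTo-split f k m)) (+-assoc (sumTo f k) _ _))

sumTo-swap : ∀ (f : ℕ → ℕ → ℕ) m n →
  sumTo (λ i → sumTo (f i) n) m ≡ sumTo (λ j → sumTo (λ i → f i j) m) n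
sumTo-swap f zero    n = sym (sumTo-zero n)
sumTo-swap f (suc m) n = trans (cong (_+ sumTo (f m) n) (sumTo-swap f m n)) (sym (sumTo-+ _ (f m) n))

sumTo-const≤ : ∀ c {f} m → (∀ i → i < m → c ≤ f i) → m * c ≤ sumTo f m
sumTo-const≤ c     zero    le = z≤n
sumTo-const≤ c {f} (suc m) le = begin
  c + m * c      ≡⟨ +-comm c (m * c) ⟩
  m * c + c      ≤⟨ +-mono-≤ (sumTo-const≤ c m λ i i<m → le i (m<n⇒m<1+n i<m)) (le m ≤-refl) ⟩
  sumTo f m + f m ∎
  where open ≤-Reasoning

sumTo-block≤ : ∀ c f k m {n} → k + m ≤ n → (∀ i → i < m → c ≤ f (k + i)) → m * c ≤ sumTo f n
sumTo-block≤ c f k m {n} k+m≤n le = begin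
  m * c                                   ≤⟨ sumTo-const≤ c m le ⟩
  sumTo (λ i → f (k + i)) m               ≤⟨ m≤n+m _ (sumTo f k) ⟩
  sumTo f k + sumTo (λ i → f (k + i)) m   ≡⟨ sumTo-split f k m ⟨
  sumTo f (k + m)                         ≤⟨ sumTo-monoʳ f k+m≤n ⟩
  sumTo f n                               ∎
  where open ≤-Reasoning

sumTo-truncate : ∀ {f m} n → (∀ i → m ≤ i → f i ≡ 0) → sumTo f n ≤ sumTo f m
sumTo-truncate zero vanish = z≤n
sumTo-truncate {f} {m} (suc n) vanish with ≤-total m n
... | inj₁ m≤n rewrite vanish n m≤n | +-identityʳ (sumTo f n) = sumTo-truncate n vanish
... | inj₂ n≤m with m≤n⇒m<n∨m≡n n≤m
...   | inj₁ n<m  = sumTo-monoʳ f n<m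
...   | inj₂ refl rewrite vanish n ≤-refl | +-identityʳ (sumTo f n) = ≤-refl

-- The interval [c - p, c + q), with the subtraction moved to the other side so that it stays exact
-- when `p` exceeds `c`.
interval : (c p q t : ℕ) → Bool
interval c p q t = (c ≤ᵇ t + p) ∧ (t <ᵇ c + q)

interval-intro : ∀ {c p q t} → c ≤ t + p → t < c + q → T (interval c p q t)
interval-intro l r = T-∧-intro (≤⇒≤ᵇ l) (<⇒<ᵇ r)

interval-elim : ∀ c p q t → T (interval c p q t) → c ≤ t + p × t < c + q
interval-elim c p q t x = let (l , r) = T-∧-elim x in ≤ᵇ⇒≤ c (t + p) l , <ᵇ⇒< t (c + q) r

sumTo-interval : ∀ c p q n → sumTo (λ t → 𝟙 (interval c p q t)) n ≤ p + q
sumTo-interval c p q n = proj₁ (both n)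
  where
  F : ℕ → ℕ
  F = sumTo (λ t → 𝟙 (interval c p q t))

  -- The second bound drives the induction; it yields the first one only while `n` lies in the
  -- interval, hence the pair.
  both : ∀ n → F n ≤ p + q × F n ≤ (n + p) ∸ c
  both zero = z≤n , z≤n
  both (suc n) with interval c p q n in eq
  ... | false rewrite +-identityʳ (F n) =
    proj₁ (both n) , ≤-trans (proj₂ (both n)) (∸-monoˡ-≤ c (n≤1+n (n + p)))
  ... | true  = ≤-trans step bound , step
    where
    open ≤-Reasoning
    ends = interval-elim c p q n (subst T (sym eq) _)
    step : F n + 1 ≤ suc (n + p) ∸ c
    step = begin
      F n + 1              ≤⟨ +-monoˡ-≤ 1 (proj₂ (both n)) ⟩
      (n + p) ∸ c + 1      ≡⟨ +-comm _ 1 ⟩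
      1 + ((n + p) ∸ c)    ≡⟨ +-∸-assoc 1 (proj₁ ends) ⟨
      suc (n + p) ∸ c      ∎
    bound : suc (n + p) ∸ c ≤ p + q
    bound = m≤n+o⇒m∸n≤o (suc (n + p)) c (≤-linear 0 (proj₂ ends) (eq′ n p c q))
      where
      eq′ : ∀ n p c q → suc (n + p) + (c + q) + 0 ≡ suc n + (c + (p + q))
      eq′ = solve-∀

sumTo-point : ∀ r n → sumTo (λ s → 𝟙 (r ≡ᵇ s)) n ≤ 1
sumTo-point r n = ≤-trans (sumTo-mono n λ s _ → 𝟙-mono {r ≡ᵇ s} {interval r 0 1 s} λ e → aux s (≡ᵇ⇒≡ r s e)) (sumTo-interval r 0 1 n)
  where
  aux : ∀ s → r ≡ s → T (interval r 0 1 s)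
  aux s refl = interval-intro {r} {0} {1} {r} (≤-reflexive (sym (+-identityʳ r))) (≤-reflexive (+-comm 1 r))

-- Sums over lists

module _ {X : Set} where

  sumL : (X → ℕ) → List X → ℕ
  sumL f []       = 0
  sumL f (x ∷ xs) = f x + sumL f xs

  sumL-cong : ∀ {f g} → (∀ x → f x ≡ g x) → ∀ xs → sumL f xs ≡ sumL g xs
  sumL-cong eq []       = refl
  sumL-cong eq (x ∷ xs) = cong₂ _+_ (eq x) (sumL-cong eq xs)

  sumL-mono : ∀ {f g xs} → All (λ x → f x ≤ g x) xs → sumL f xs ≤ sumL g xs
  sumL-mono []         = z≤n
  sumL-mono (le ∷ les) = +-mono-≤ le (sumL-mono les)

  sumL-≤ : ∀ {f g} → (∀ x → f x ≤ g x) → ∀ xs → sumL f xs ≤ sumL g xs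
  sumL-≤ le []       = z≤n
  sumL-≤ le (x ∷ xs) = +-mono-≤ (le x) (sumL-≤ le xs)

  sumL-zero : ∀ xs → sumL (λ _ → 0) xs ≡ 0
  sumL-zero []       = refl
  sumL-zero (x ∷ xs) = sumL-zero xs

  sumL-+ : ∀ f g xs → sumL (λ x → f x + g x) xs ≡ sumL f xs + sumL g xs
  sumL-+ f g []       = refl
  sumL-+ f g (x ∷ xs) = trans (cong (f x + g x +_) (sumL-+ f g xs)) (+-interchange (f x) (g x) (sumL f xs) (sumL g xs))

  sumL-*ˡ : ∀ c f xs → sumL (λ x → c * f x) xs ≡ c * sumL f xs
  sumL-*ˡ c f []       = sym (*-zeroʳ c)
  sumL-*ˡ c f (x ∷ xs) = trans (cong (c * f x +_) (sumL-*ˡ c f xs)) (sym (*-distribˡ-+ c (f x) _))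

  sumL-const : ∀ c xs → sumL (λ _ → c) xs ≡ length xs * c
  sumL-const c []       = refl
  sumL-const c (x ∷ xs) = cong (c +_) (sumL-const c xs)

  sumTo-sumL : ∀ (f : ℕ → X → ℕ) xs n →
    sumTo (λ t → sumL (f t) xs) n ≡ sumL (λ x → sumTo (λ t → f t x) n) xs
  sumTo-sumL f xs zero    = sym (sumL-zero xs)
  sumTo-sumL f xs (suc n) = trans (cong (_+ sumL (f n) xs) (sumTo-sumL f xs n)) (sym (sumL-+ _ (f n) xs))

-- Openings still in use

window : (ℕ → ℕ) → ℕ → ℕ → ℕ
window o zero    n       = 0
window o (suc l) zero    = 0
window o (suc l) (suc n) = o n + window o l n

window-cong : ∀ {o p} l n → (∀ s → s < n → o s ≡ p s) → window o l n ≡ window p l n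
window-cong zero    n       eq = refl
window-cong (suc l) zero    eq = refl
window-cong (suc l) (suc n) eq = cong₂ _+_ (eq n ≤-refl) (window-cong l n λ s s<n → eq s (m<n⇒m<1+n s<n))

window-split : ∀ o len n → sumTo o n ≡ window o len n + sumTo o (n ∸ len)
window-split o zero      n       = refl
window-split o (suc len) zero    = refl
window-split o (suc len) (suc n) = begin
  sumTo o n + o n                                ≡⟨ +-comm (sumTo o n) (o n) ⟩
  o n + sumTo o n                                ≡⟨ cong (o n +_) (window-split o len n) ⟩
  o n + (window o len n + sumTo o (n ∸ len))     ≡⟨ +-assoc (o n) _ _ ⟨
  o n + window o len n + sumTo o (n ∸ len)       ∎
  where open ≡-Reasoning

-- Bridge to the shape of `algActive`, which filters all past openings by an indicator.
window-sumTo : ∀ o len n → sumTo (λ s → if n ≤ᵇ s + len then o s else 0) n ≡ window o len n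
window-sumTo o zero n = trans (sumTo-cong n vanish) (sumTo-zero n)
  where
  vanish : ∀ s → s < n → (if n ≤ᵇ s + 0 then o s else 0) ≡ 0
  vanish s s<n with n ≤ᵇ s + 0 in eq
  ... | false = refl
  ... | true  = contradiction (subst (n ≤_) (+-identityʳ s) (≤ᵇ⇒≤ n (s + 0) (subst T (sym eq) _))) (<⇒≱ s<n)
window-sumTo o (suc len) zero    = refl
window-sumTo o (suc len) (suc n) =
  trans (+-comm _ (if suc n ≤ᵇ n + suc len then o n else 0))
        (cong₂ _+_ newest (trans (sumTo-cong n shift) (window-sumTo o len n)))
  where
  newest : (if suc n ≤ᵇ n + suc len then o n else 0) ≡ o n
  newest rewrite Equivalence.to T-≡ (≤⇒≤ᵇ (≤-trans (s≤s (m≤m+n n len)) (≤-reflexive (sym (+-suc n len))))) = refl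
  shift : ∀ s → s < n → (if suc n ≤ᵇ s + suc len then o s else 0) ≡ (if n ≤ᵇ s + len then o s else 0)
  shift s _ rewrite +-suc s len = cong (λ b → if b then o s else 0) (suc-≤ᵇ n (s + len))
    where
    suc-≤ᵇ : ∀ m n → (suc m ≤ᵇ suc n) ≡ (m ≤ᵇ n)
    suc-≤ᵇ zero    n = refl
    suc-≤ᵇ (suc m) n = refl

window-mono : ∀ o {k l} n → k ≤ l → window o k n ≤ window o l n
window-mono o {zero}          n       z≤n       = z≤n
window-mono o {suc k} {suc l} zero    (s≤s k≤l) = z≤n
window-mono o {suc k} {suc l} (suc n) (s≤s k≤l) = +-monoʳ-≤ (o n) (window-mono o n k≤l)

window-later : ∀ o l m n → window o l n ≤ window o (m + l) (m + n)
window-later o l zero    n = ≤-refl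
window-later o l (suc m) n = ≤-trans (window-later o l m n) (m≤n+m _ (o (m + n)))

window≤sumTo : ∀ o l n → window o l n ≤ sumTo o n
window≤sumTo o l n = subst (window o l n ≤_) (sym (window-split o l n)) (m≤m+n _ _)

-- Work-conserving service of unit jobs

-- The queue before the arrivals of time `t`; `load` is the queue after them, so a job can be served
-- at its release time.
backlog : (A β : ℕ → ℕ) → ℕ → ℕ
backlog A β zero    = 0
backlog A β (suc t) = (backlog A β t + β t) ∸ A t

load : (A β : ℕ → ℕ) → ℕ → ℕ
load A β t = backlog A β t + β t

backlog-cong : ∀ {A B β γ} t → (∀ s → s < t → A s ≡ B s) → (∀ s → s < t → β s ≡ γ s) →
  backlog A β t ≡ backlog B γ t
backlog-cong zero    eqA eqβ = refl
backlog-cong (suc t) eqA eqβ = cong₂ _∸_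
  (cong₂ _+_ (backlog-cong t (λ s s<t → eqA s (m<n⇒m<1+n s<t)) (λ s s<t → eqβ s (m<n⇒m<1+n s<t))) (eqβ t ≤-refl))
  (eqA t ≤-refl)

backlog-mono : ∀ A {β γ} → (∀ s → β s ≤ γ s) → ∀ t → backlog A β t ≤ backlog A γ t
backlog-mono A le zero    = z≤n
backlog-mono A le (suc t) = ∸-monoˡ-≤ (A t) (+-mono-≤ (backlog-mono A le t) (le t))

∸-+-⊔ : ∀ m n → m ∸ n + n ≡ m + (n ∸ m)
∸-+-⊔ zero    n       = cong (_+ n) (0∸n≡0 n)
∸-+-⊔ (suc m) zero    = refl
∸-+-⊔ (suc m) (suc n) = trans (+-suc (m ∸ n) n) (cong suc (∸-+-⊔ m n))

-- Lindley's formula: the backlog is the excess of work over capacity since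
-- the last time at which it was zero.
backlog-busy-period : ∀ A β t → ∃ λ t₀ → ∃ λ n → t₀ + n ≡ t ×
  backlog A β t + sumTo (λ i → A (t₀ + i)) n ≤ sumTo (λ i → β (t₀ + i)) n
backlog-busy-period A β zero = 0 , 0 , refl , z≤n
backlog-busy-period A β (suc t) with ≤-total (load A β t) (A t) | backlog-busy-period A β t
... | inj₁ idle | _ =
  suc t , 0 , +-identityʳ _ , ≤-reflexive (trans (+-identityʳ _) (m≤n⇒m∸n≡0 idle))
... | inj₂ busy | t₀ , n , refl , le = t₀ , suc n , +-suc t₀ n ,
  ≤-linear 0 (+-mono-≤ le (≤-reflexive (m∸n+n≡m busy)))
    (eq (load A β (t₀ + n) ∸ A (t₀ + n)) (sumTo (λ i → A (t₀ + i)) n) (A (t₀ + n))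
        (sumTo (λ i → β (t₀ + i)) n) (backlog A β (t₀ + n)) (β (t₀ + n)))
  where
  eq : ∀ x a a′ b y b′ → x + (a + a′) + (b + (y + b′)) + 0 ≡ y + a + (x + a′) + (b + b′)
  eq = solve-∀

-- Meant for `β` counting only jobs due by `t`: then the intervals ending at `t` are the ones that
-- matter, and there is one condition per deadline.
Hall : (A β : ℕ → ℕ) → ℕ → Set
Hall A β t = ∀ t₀ n → t₀ + n ≡ t → sumTo (λ i → β (t₀ + i)) n ≤ sumTo (λ i → A (t₀ + i)) n

Hall⇒backlog≡0 : ∀ {A β t} → Hall A β t → backlog A β t ≡ 0
Hall⇒backlog≡0 {A} {β} {t} hall with backlog-busy-period A β t
... | t₀ , n , eq , le = n≤0⇒n≡0 (+-cancelʳ-≤ (sumTo (λ i → A (t₀ + i)) n) _ 0 (≤-trans le (hall t₀ n eq)))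

backlog≡0⇒Hall : ∀ {A β t} → backlog A β t ≡ 0 → Hall A β t
backlog≡0⇒Hall {A} {β} empty t₀ n refl = begin
  sumTo (λ i → β (t₀ + i)) n                              ≤⟨ m≤n+m _ (backlog A β t₀) ⟩
  backlog A β t₀ + sumTo (λ i → β (t₀ + i)) n             ≤⟨ served n ⟩
  sumTo (λ i → A (t₀ + i)) n + backlog A β (t₀ + n)       ≡⟨ cong (sumTo (λ i → A (t₀ + i)) n +_) empty ⟩
  sumTo (λ i → A (t₀ + i)) n + 0                          ≡⟨ +-identityʳ _ ⟩
  sumTo (λ i → A (t₀ + i)) n                              ∎
  where
  open ≤-Reasoning
  eq : ∀ x b b′ a y a′ z → x + (b + b′) + (a + y + (a′ + z)) + 0 ≡ x + b + (y + b′) + (a + a′ + z)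
  eq = solve-∀
  served : ∀ n → backlog A β t₀ + sumTo (λ i → β (t₀ + i)) n ≤ sumTo (λ i → A (t₀ + i)) n + backlog A β (t₀ + n)
  served zero    = ≤-reflexive (trans (+-identityʳ _) (cong (backlog A β) (sym (+-identityʳ t₀))))
  served (suc n) rewrite +-suc t₀ n =
    ≤-linear 0 (+-mono-≤ (served n) (m≤n+m∸n (load A β (t₀ + n)) (A (t₀ + n))))
      (eq (backlog A β t₀) (sumTo (λ i → β (t₀ + i)) n) (β (t₀ + n)) (sumTo (λ i → A (t₀ + i)) n)
          (backlog A β (t₀ + n)) (A (t₀ + n)) (load A β (t₀ + n) ∸ A (t₀ + n)))

-- The reason for leaving empty backlogs for Hall's condition: additivity lets two separately
-- planned capacities serve one common queue.
Hall-+ : ∀ {A B β γ t} → Hall A β t → Hall B γ t → Hall (λ s → A s + B s) (λ s → β s + γ s) t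
Hall-+ {A} {B} {β} {γ} hallA hallB t₀ n eq = subst₂ _≤_
  (sym (sumTo-+ (λ i → β (t₀ + i)) (λ i → γ (t₀ + i)) n))
  (sym (sumTo-+ (λ i → A (t₀ + i)) (λ i → B (t₀ + i)) n))
  (+-mono-≤ (hallA t₀ n eq) (hallB t₀ n eq))

-- A job released at r, when the jobs of higher priority arrive according to β,
-- is pending as long as the backlogs with and without it differ.

withJob : (ℕ → ℕ) → ℕ → ℕ → ℕ
withJob β r s = β s + 𝟙 (r ≡ᵇ s)

runsAt : (A β : ℕ → ℕ) (r t : ℕ) → Bool
runsAt A β r t = not (load A (withJob β r) t ≡ᵇ load A β t)
               ∧ (backlog A (withJob β r) (suc t) ≡ᵇ backlog A β (suc t))

module _ (A β : ℕ → ℕ) (r : ℕ) where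

  private
    β⁺ : ℕ → ℕ
    β⁺ = withJob β r

  runsAt-elim : ∀ t → T (runsAt A β r t) →
    load A β⁺ t ≢ load A β t × backlog A β⁺ (suc t) ≡ backlog A β (suc t)
  runsAt-elim t run with load A β⁺ t ≡ᵇ load A β t in eq
  ... | false = (λ same → subst T eq (≡⇒≡ᵇ _ _ same)) , ≡ᵇ⇒≡ _ _ run

  runsAt-intro : ∀ t → load A β⁺ t ≢ load A β t → backlog A β⁺ (suc t) ≡ backlog A β (suc t) → T (runsAt A β r t)
  runsAt-intro t diff same with load A β⁺ t ≡ᵇ load A β t in eq
  ... | false = ≡⇒≡ᵇ _ _ same
  ... | true  = diff (≡ᵇ⇒≡ _ _ (subst T (sym eq) _))

  withJob-≢ : ∀ t → r ≢ t → β⁺ t ≡ β t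
  withJob-≢ t r≢t = trans (cong (β t +_) (𝟙-false λ e → r≢t (≡ᵇ⇒≡ r t e))) (+-identityʳ _)

  withJob-≡ : β⁺ r ≡ suc (β r)
  withJob-≡ = trans (cong (β r +_) (𝟙-true (≡⇒≡ᵇ r r refl))) (+-comm (β r) 1)

  backlog-before : ∀ {t} → t ≤ r → backlog A β⁺ t ≡ backlog A β t
  backlog-before {t} t≤r = backlog-cong t (λ _ _ → refl) λ s s<t → withJob-≢ s λ { refl → <⇒≱ s<t t≤r }

  runs⇒released : ∀ t → T (runsAt A β r t) → r ≤ t
  runs⇒released t run with r ≤? t
  ... | yes r≤t = r≤t
  ... | no  r≰t = contradiction
    (cong₂ _+_ (backlog-before (<⇒≤ (≰⇒> r≰t))) (withJob-≢ t λ { refl → r≰t ≤-refl }))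
    (proj₁ (runsAt-elim t run))

  -- After the release both queues see the same arrivals, so once equal they stay equal; hence a job
  -- runs at most once.
  backlog-after : ∀ {t} → r < t → backlog A β⁺ t ≡ backlog A β t → ∀ k → backlog A β⁺ (k + t) ≡ backlog A β (k + t)
  backlog-after r<t same zero    = same
  backlog-after {t} r<t same (suc k) = cong (_∸ A (k + t)) (cong₂ _+_ (backlog-after r<t same k)
    (withJob-≢ (k + t) λ { refl → <⇒≱ r<t (m≤n+m t k) }))

  runs-later : ∀ {t t′} → T (runsAt A β r t) → T (runsAt A β r t′) → ¬ (t < t′)
  runs-later {t} {t′} run run′ t<t′ = proj₁ (runsAt-elim t′ run′) (cong₂ _+_
    (subst (λ n → backlog A β⁺ n ≡ backlog A β n) (m∸n+n≡m t<t′)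
      (backlog-after (s≤s r≤t) (proj₂ (runsAt-elim t run)) (t′ ∸ suc t)))
    (withJob-≢ t′ λ { refl → <⇒≱ t<t′ r≤t }))
    where r≤t = runs⇒released t run

  runs-unique : ∀ {t t′} → T (runsAt A β r t) → T (runsAt A β r t′) → t′ ≡ t
  runs-unique run run′ = ≤-antisym (≮⇒≥ (runs-later run run′)) (≮⇒≥ (runs-later run′ run))

  -- The queues with and without the job differ at `r` and are both empty at `d`; the job runs at
  -- the step at which they first meet.
  runs-exists : ∀ {d} → r < d → backlog A β⁺ d ≡ 0 → ∃ λ t → T (runsAt A β r t) × t < d
  runs-exists {d} r<d empty = search (d ∸ suc r) r (m∸n+n≡m r<d) pending
    where
    pending : load A β⁺ r ≢ load A β r
    pending same = 1+n≢n (+-cancelˡ-≡ (backlog A β r) _ _ (trans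
      (cong₂ _+_ (sym (backlog-before ≤-refl)) (sym withJob-≡)) same))
    empty′ : backlog A β d ≡ 0
    empty′ = n≤0⇒n≡0 (≤-trans (backlog-mono A (λ s → m≤m+n (β s) _) d) (≤-reflexive empty))
    search : ∀ k t → k + suc t ≡ d → load A β⁺ t ≢ load A β t → ∃ λ t → T (runsAt A β r t) × t < d
    search k t eq diff with backlog A β⁺ (suc t) ≟ backlog A β (suc t)
    ... | yes same = t , runsAt-intro t diff same , subst (t <_) eq (m≤n+m (suc t) k)
    search zero    t refl diff | no diff′ = contradiction (trans empty (sym empty′)) diff′
    search (suc k) t eq   diff | no diff′ = search k (suc t) (trans (+-suc k (suc t)) eq)
      λ same → diff′ (lemma same)
      where
      lemma : load A β⁺ (suc t) ≡ load A β (suc t) → backlog A β⁺ (suc t) ≡ backlog A β (suc t)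
      lemma same = ≤-antisym (+-cancelʳ-≤ (β (suc t)) _ _ (begin
        backlog A β⁺ (suc t) + β (suc t)    ≤⟨ +-monoʳ-≤ (backlog A β⁺ (suc t)) (m≤m+n (β (suc t)) _) ⟩
        load A β⁺ (suc t)                   ≡⟨ same ⟩
        load A β (suc t)                    ∎)) (backlog-mono A (λ s → m≤m+n (β s) _) (suc t))
        where open ≤-Reasoning

  load-lipschitz : ∀ t → load A β⁺ t ≤ suc (load A β t)
  load-lipschitz t with r ≤? t
  ... | no r≰t = m≤n⇒m≤1+n (≤-reflexive (cong₂ _+_ (backlog-before (<⇒≤ (≰⇒> r≰t))) (withJob-≢ t λ { refl → r≰t ≤-refl })))
  ... | yes r≤t with m≤n⇒m<n∨m≡n r≤t
  ...   | inj₂ refl rewrite withJob-≡ = ≤-reflexive (trans (+-suc _ (β r)) (cong (λ x → suc (x + β r)) (backlog-before ≤-refl)))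
  ...   | inj₁ r<t rewrite withJob-≢ t (<⇒≢ r<t) = +-monoˡ-≤ (β t) (step t r<t)
    where
    step : ∀ t → r < t → backlog A β⁺ t ≤ suc (backlog A β t)
    step (suc t) (s≤s r≤t) = ≤-trans (∸-monoˡ-≤ (A t) (load-lipschitz t)) (suc-∸ (load A β t) (A t))
      where
      suc-∸ : ∀ m n → suc m ∸ n ≤ suc (m ∸ n)
      suc-∸ m       zero    = ≤-refl
      suc-∸ zero    (suc n) = ≤-trans (≤-reflexive (0∸n≡0 n)) z≤n
      suc-∸ (suc m) (suc n) = suc-∸ m n

  -- If the job runs, the load with it is larger by exactly one (`load-lipschitz`) but leaves the
  -- same backlog, so one more unit is served. Telescoping this bounds the number of jobs run at
  -- once.
  runs-served : ∀ t → 𝟙 (runsAt A β r t) + load A β t ⊓ A t ≤ load A β⁺ t ⊓ A t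
  runs-served t with runsAt A β r t in eq
  ... | false = ⊓-monoˡ-≤ (A t) (+-mono-≤ (backlog-mono A (λ s → m≤m+n (β s) _) t) (m≤m+n (β t) _))
  ... | true  = served (load A β⁺ t) (load A β t) (A t) (≤-antisym (load-lipschitz t) (≤∧≢⇒< le (λ e → proj₁ run (sym e)))) (proj₂ run)
    where
    run = runsAt-elim t (subst T (sym eq) _)
    le = +-mono-≤ (backlog-mono A {β} {β⁺} (λ s → m≤m+n (β s) _) t) (m≤m+n (β t) (𝟙 (r ≡ᵇ t)))
    served : ∀ x y a → x ≡ suc y → x ∸ a ≡ y ∸ a → suc (y ⊓ a) ≤ x ⊓ a
    served _ y       zero    refl e = contradiction e (1+n≢n)
    served _ zero    (suc a) refl e = s≤s z≤n
    served _ (suc y) (suc a) refl e = s≤s (served (suc y) y a refl e)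

window-+ : ∀ o p l n → window (λ s → o s + p s) l n ≡ window o l n + window p l n
window-+ o p zero    n       = refl
window-+ o p (suc l) zero    = refl
window-+ o p (suc l) (suc n) = trans (cong (o n + p n +_) (window-+ o p l n)) (+-interchange (o n) (p n) (window o l n) (window p l n))

-- The index `suc t` includes the openings of time `t`, which are usable at once.
active : (ℕ → ℕ) → ℕ → ℕ → ℕ
active o l t = window o l (suc t)

-- The capacity from time n on of the calibrations opened before n, when the
-- newest of them has l slots left.
future : (ℕ → ℕ) → ℕ → ℕ → ℕ
future o zero    n       = 0
future o (suc l) zero    = 0
future o (suc l) (suc n) = suc l * o n + future o l n

future-cong : ∀ {o p} l n → (∀ s → s < n → o s ≡ p s) → future o l n ≡ future p l n
future-cong zero    n       eq = refl
future-cong (suc l) zero    eq = refl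
future-cong (suc l) (suc n) eq = cong₂ _+_ (cong (suc l *_) (eq n ≤-refl)) (future-cong l n λ s s<n → eq s (m<n⇒m<1+n s<n))

-- The slots of the current step are split off; every calibration then has one slot fewer.
future-step : ∀ o l n → future o (suc l) n ≡ window o (suc l) n + future o l n
future-step o zero    zero    = refl
future-step o (suc l) zero    = refl
future-step o zero    (suc n) = eq (o n)
  where
  eq : ∀ x → 1 * x + 0 ≡ x + 0 + 0
  eq = solve-∀
future-step o (suc l) (suc n) = trans (cong (suc (suc l) * o n +_) (future-step o l n)) (eq l (o n) (window o (suc l) n) (future o l n))
  where
  eq : ∀ l x w f → suc (suc l) * x + (w + f) ≡ x + w + (suc l * x + f)
  eq = solve-∀

-- A calibration opened at `z` contributes `l - k` slots on its own.
future-opened : ∀ o z → 1 ≤ o z → ∀ l k → l ≤ future o l (suc k + z) + k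
future-opened o z opened zero    k       = z≤n
future-opened o z opened (suc l) zero    = begin
  suc l                               ≡⟨ *-identityʳ (suc l) ⟨
  suc l * 1                           ≤⟨ *-monoʳ-≤ (suc l) opened ⟩
  suc l * o z                         ≤⟨ m≤m+n _ (future o l z) ⟩
  suc l * o z + future o l z          ≡⟨ +-identityʳ _ ⟨
  suc l * o z + future o l z + 0      ∎
  where open ≤-Reasoning
future-opened o z opened (suc l) (suc k) = ≤-linear (suc l * o (suc k + z)) (future-opened o z opened l k)
  (eq l (future o l (suc k + z)) k (suc l * o (suc k + z)))
  where
  eq : ∀ l f k x → suc l + (f + k) + x ≡ l + (x + f + suc k)
  eq = solve-∀

-- Causal recursion

Causal : ((ℕ → ℕ) → ℕ → ℕ) → Set
Causal rule = ∀ {o p} t → (∀ s → s < t → o s ≡ p s) → rule o t ≡ rule p t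

-- Course-of-values recursion made structural: `prefix rule t` is meaningful below `t` only, and a
-- causal rule looks no further.
prefix : ((ℕ → ℕ) → ℕ → ℕ) → ℕ → ℕ → ℕ
prefix rule zero    s = 0
prefix rule (suc t) s = if s <ᵇ t then prefix rule t s else rule (prefix rule t) t

causalFix : ((ℕ → ℕ) → ℕ → ℕ) → ℕ → ℕ
causalFix rule t = rule (prefix rule t) t

prefix-correct : ∀ rule t s → s < t → prefix rule t s ≡ causalFix rule s
prefix-correct rule (suc t) s (s≤s s≤t) with s <ᵇ t in eq
... | true  = prefix-correct rule t s (<ᵇ⇒< s t (subst T (sym eq) _))
... | false with m≤n⇒m<n∨m≡n s≤t
...   | inj₁ s<t  = ⊥-elim (subst T eq (<⇒<ᵇ s<t))
...   | inj₂ refl = refl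

causalFix-unfold : ∀ rule → Causal rule → ∀ t → causalFix rule t ≡ rule (causalFix rule) t
causalFix-unfold rule causal t = causal t (prefix-correct rule t)

-- This makes the plan online: rules built from the view and from the whole instance agree up to
-- now, hence so do the openings.
causalFix-cong : ∀ {rule rule′} → Causal rule → Causal rule′ → ∀ n →
  (∀ o t → t < n → rule o t ≡ rule′ o t) → ∀ t → t < n → causalFix rule t ≡ causalFix rule′ t
causalFix-cong {rule} {rule′} causal causal′ (suc n) agree t (s≤s t≤n) = begin
  causalFix rule t               ≡⟨ causalFix-unfold rule causal t ⟩
  rule (causalFix rule) t        ≡⟨ causal t (λ s s<t → causalFix-cong causal causal′ n (λ o u u<n → agree o u (m<n⇒m<1+n u<n)) s (<-≤-trans s<t t≤n)) ⟩
  rule (causalFix rule′) t       ≡⟨ agree (causalFix rule′) t (s≤s t≤n) ⟩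
  rule′ (causalFix rule′) t      ≡⟨ causalFix-unfold rule′ causal′ t ⟨
  causalFix rule′ t              ∎
  where open ≡-Reasoning

-- ceilDiv n d is ⌈n / (d + 1)⌉.
ceilDiv : ℕ → ℕ → ℕ
ceilDiv n d = (n + d) / suc d

≤-ceilDiv : ∀ n d → n ≤ ceilDiv n d * suc d
≤-ceilDiv n d = ≤-linear 0 (+-mono-≤ (≤-reflexive (m≡m%n+[m/n]*n (n + d) (suc d))) (≤-pred (m%n<n (n + d) (suc d))))
  (eq n d ((n + d) % suc d) (ceilDiv n d * suc d))
  where
  eq : ∀ n d r q → n + (r + q + d) + 0 ≡ n + d + r + q
  eq = solve-∀

ceilDiv-least : ∀ {n} d {k} → n ≤ k * suc d → ceilDiv n d ≤ k
ceilDiv-least {n} d {k} n≤ = ≤-pred (m<n*o⇒m/o<n {n + d} {suc k} {suc d} (≤-linear 0 n≤ (eq n d k)))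
  where
  eq : ∀ n d k → suc (n + d) + k * suc d + 0 ≡ n + suc k * suc d
  eq = solve-∀

-- Jobs with long windows

module Long (H′ : ℕ) where

  H : ℕ
  H = suc H′

  -- Jobs due by `t + H` precede all others, so their queue is computed as though nothing else had
  -- arrived. The horizon `t + H` is held fixed over the whole past.
  due : (ℕ → ℕ → ℕ) → (ℕ → ℕ) → ℕ → ℕ
  due α o t = load (active o H) (λ s → α s (t + H)) t

  -- Only the shortfall is opened, rounded up; the surplus is less than one calibration, which is
  -- the `H` in `balance`.
  rule : (ℕ → ℕ → ℕ) → (ℕ → ℕ) → ℕ → ℕ
  rule α o t = ceilDiv (due α o t ∸ future o H′ t) H′

  openings : (ℕ → ℕ → ℕ) → ℕ → ℕ
  openings α = causalFix (rule α)

  rule-causal : ∀ α → Causal (rule α)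
  rule-causal α t eq = cong₂ (λ x y → ceilDiv (x + α t (t + H) ∸ y) H′)
    (backlog-cong t (λ s s<t → window-cong H (suc s) λ u u<1+s → eq u (≤-trans u<1+s s<t)) λ _ _ → refl)
    (future-cong H′ t eq)

  openings-cong : ∀ {α α′} n → (∀ s d → s < n → α s d ≡ α′ s d) → ∀ t → t < n → openings α t ≡ openings α′ t
  openings-cong {α} {α′} n agree = causalFix-cong (rule-causal α) (rule-causal α′) n λ o t t<n →
    cong (λ x → ceilDiv (x ∸ future o H′ t) H′)
      (cong₂ _+_ (backlog-cong t (λ _ _ → refl) λ s s<t → agree s (t + H) (<-trans s<t t<n)) (agree t (t + H) t<n))

  openings-unfold : ∀ α t → openings α t ≡ rule α (openings α) t
  openings-unfold α = causalFix-unfold (rule α) (rule-causal α)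

  module _ (α : ℕ → ℕ → ℕ) (o : ℕ → ℕ) (o-unfold : ∀ t → o t ≡ rule α o t) where

    private
      A : ℕ → ℕ
      A = active o H

    due≤future : ∀ t → due α o t ≤ future o H (suc t)
    due≤future t = begin
      due α o t                                                       ≤⟨ m≤n+m∸n (due α o t) (future o H′ t) ⟩
      future o H′ t + (due α o t ∸ future o H′ t)                     ≤⟨ +-monoʳ-≤ (future o H′ t) (≤-ceilDiv _ H′) ⟩
      future o H′ t + rule α o t * H                                  ≡⟨ cong (λ x → future o H′ t + x * H) (o-unfold t) ⟨
      future o H′ t + o t * H                                         ≡⟨ +-comm (future o H′ t) (o t * H) ⟩
      o t * H + future o H′ t                                         ≡⟨ cong (_+ future o H′ t) (*-comm (o t) H) ⟩
      H * o t + future o H′ t                                         ∎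
      where open ≤-Reasoning

    module _ (late : ∀ s d → d < s + H → α s d ≡ 0) where

      -- By `late` nothing released after `t` joins this queue, and the calibrations open at `t` end
      -- by `t + H`. Each step removes one layer of `future` from the bound, down to zero; later
      -- openings only help.
      drained : ∀ t l k → k + l ≡ H′ → backlog A (λ s → α s (t + H)) (k + suc t) ≤ future o l (suc t) →
        backlog A (λ s → α s (t + H)) (l + (k + suc t)) ≡ 0
      drained t zero    k eq le = n≤0⇒n≡0 le
      drained t (suc l) k eq le = subst (λ n → backlog A (λ s → α s (t + H)) n ≡ 0) (+-suc l (k + suc t))
        (drained t l (suc k) (trans (sym (+-suc k l)) eq) (begin
          backlog A β (k + suc t) + β (k + suc t) ∸ A (k + suc t)   ≡⟨ cong (λ x → backlog A β (k + suc t) + x ∸ A (k + suc t)) none ⟩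
          backlog A β (k + suc t) + 0 ∸ A (k + suc t)               ≡⟨ cong (_∸ A (k + suc t)) (+-identityʳ _) ⟩
          backlog A β (k + suc t) ∸ A (k + suc t)                   ≤⟨ ∸-mono le alive ⟩
          future o (suc l) (suc t) ∸ window o (suc l) (suc t)       ≡⟨ cong (_∸ window o (suc l) (suc t)) (future-step o l (suc t)) ⟩
          window o (suc l) (suc t) + future o l (suc t) ∸ window o (suc l) (suc t) ≡⟨ m+n∸m≡n (window o (suc l) (suc t)) _ ⟩
          future o l (suc t)                                        ∎))
        where
        open ≤-Reasoning
        β : ℕ → ℕ
        β s = α s (t + H)
        none : β (k + suc t) ≡ 0
        none = late (k + suc t) (t + H) (+-monoˡ-< H (m≤n+m (suc t) k))
        alive : window o (suc l) (suc t) ≤ A (k + suc t)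
        alive = ≤-trans (window-later o (suc l) (suc k) (suc t))
          (≤-reflexive (cong (λ x → window o (suc x) (suc k + suc t)) eq))

      feasible : ∀ d → Hall A (λ s → α s d) d
      feasible d with H ≤? d
      ... | no H≰d = λ t₀ n _ → ≤-trans (≤-reflexive (trans
        (sumTo-cong n λ i _ → late (t₀ + i) d (≤-trans (≰⇒> H≰d) (m≤n+m H (t₀ + i)))) (sumTo-zero n))) z≤n
      ... | yes H≤d = backlog≡0⇒Hall (subst (λ x → backlog A (λ s → α s x) x ≡ 0) (m∸n+n≡m H≤d)
        (subst (λ x → backlog A (λ s → α s (t + H)) x ≡ 0) (trans (+-suc H′ t) (+-comm H t))
          (drained t H′ 0 refl (m≤n+o⇒m∸n≤o (due α o t) (A t)
            (≤-trans (due≤future t) (≤-reflexive (future-step o H′ (suc t))))))))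
        where t = d ∸ H

    module _ (α∞ cov : ℕ → ℕ) (α≤α∞ : ∀ s d → α s d ≤ α∞ s)
             (cover : ∀ z k s → z < s → s ≤ k + z → 1 ≤ α s (k + z + H) → k ⊓ H ≤ sumTo (λ i → cov (z + i)) k) where

      private
        -- The horizon of `due` moves with `t`, so waste is measured against one queue `X` for all
        -- of `α∞`, which dominates the queue of each horizon.
        X waste : ℕ → ℕ
        X = backlog A α∞
        waste t = A t ∸ load A α∞ t

        F W C : ℕ → ℕ
        F = future o H′
        W = sumTo waste
        C = sumTo cov

      conservation : ∀ t → X (suc t) + A t ≡ load A α∞ t + waste t
      conservation t = ∸-+-⊔ (load A α∞ t) (A t)

      -- The state at time suc k + z when the last opening happened at z: the
      -- capacity wasted since z is at most that of a single calibration, and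
      -- as soon as some is wasted no job released by z is pending.
      record Stage (t : ℕ) : Set where
        field
          z k      : ℕ
          t≡       : t ≡ suc k + z
          opened   : 1 ≤ o z
          paid     : W z ≤ C z
          balance  : F t + W t ≤ X t + H + W z
          wasted   : W t ≤ W z + suc k ⊓ H
          idle     : (W t ≡ W z) ⊎ (∃ λ y → z ≤ y × y < t × X (suc y) ≡ 0)

      waste⇒empty : ∀ t → waste t ≢ 0 → X (suc t) ≡ 0
      waste⇒empty t w = m≤n⇒m∸n≡0 {load A α∞ t} {A t} (<⇒≤ (m∸n≢0⇒n<m {A t} {load A α∞ t} w))

      -- Without waste at `t` the bounds persist. With waste the queue is empty afterwards, and
      -- `balance` bounds the waste since `z` by `H` minus the capacity ahead; the slots left of the
      -- calibration opened at `z` turn this into the bound by elapsed time.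
      advance : ∀ {t} z k → suc t ≡ suc k + z → 1 ≤ o z → W z ≤ C z →
        F (suc t) + W (suc t) ≤ X (suc t) + H + W z →
        W t ≤ W z + suc k ⊓ H →
        (W t ≡ W z) ⊎ (∃ λ y → z ≤ y × y < t × X (suc y) ≡ 0) →
        Stage (suc t)
      advance {t} z k t≡ opened paid balance wasted idle with waste t ≟ 0
      ... | yes none = record { z = z ; k = k ; t≡ = t≡ ; opened = opened ; paid = paid ; balance = balance
        ; wasted = subst (_≤ W z + suc k ⊓ H) (sym same) wasted
        ; idle = idle′ idle }
        where
        same : W (suc t) ≡ W t
        same = trans (cong (W t +_) none) (+-identityʳ _)
        idle′ : (W t ≡ W z) ⊎ (∃ λ y → z ≤ y × y < t × X (suc y) ≡ 0) →
                (W (suc t) ≡ W z) ⊎ (∃ λ y → z ≤ y × y < suc t × X (suc y) ≡ 0)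
        idle′ (inj₁ e)                   = inj₁ (trans same e)
        idle′ (inj₂ (y , z≤y , y<t , e)) = inj₂ (y , z≤y , m<n⇒m<1+n y<t , e)
      ... | no some = record { z = z ; k = k ; t≡ = t≡ ; opened = opened ; paid = paid ; balance = balance
        ; wasted = ≤-trans (⊓-glb by-time by-length) (≤-reflexive (sym (+-distribˡ-⊓ (W z) (suc k) H)))
        ; idle = inj₂ (t , ≤-pred (subst (suc z ≤_) (sym t≡) (s≤s (m≤n+m z k))) , ≤-refl , empty) }
        where
        empty : X (suc t) ≡ 0
        empty = waste⇒empty t some
        balance′ : F (suc t) + W (suc t) ≤ H + W z
        balance′ = subst (λ x → F (suc t) + W (suc t) ≤ x + H + W z) empty balance
        by-length : W (suc t) ≤ W z + H
        by-length = ≤-linear (F (suc t)) balance′ (eq (W (suc t)) H (W z) (F (suc t)))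
          where
          eq : ∀ w h wz f → w + (h + wz) + f ≡ f + w + (wz + h)
          eq = solve-∀
        by-time : W (suc t) ≤ W z + suc k
        by-time = ≤-linear 0 (+-mono-≤ balance′ (subst (λ n → H′ ≤ F n + k) (sym t≡) (future-opened o z opened H′ k)))
          (eq (W (suc t)) H′ (W z) (F (suc t)) k)
          where
          eq : ∀ w h wz f k → w + (suc h + wz + (f + k)) + 0 ≡ f + w + h + (wz + suc k)
          eq = solve-∀

      opened⇒due : ∀ t → 1 ≤ o t → future o H′ t < due α o t
      opened⇒due t opened = m∸n≢0⇒n<m λ none → contradiction
        (≤-trans opened (≤-trans (≤-reflexive (trans (o-unfold t) (cong (λ x → ceilDiv x H′) none)))
                                 (ceilDiv-least H′ {0} z≤n))) λ()

      -- At an opening the shortfall is positive, so the capacity ahead exceeds the due work, and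
      -- all the more `X`, by at most the rounding. Conservation of work then gives `balance`.
      open-stage : ∀ t → 1 ≤ o t → W t ≤ C t → Stage (suc t)
      open-stage t opened paid = advance t 0 refl opened paid balance (m≤m+n (W t) _) (inj₁ refl)
        where
        open ≤-Reasoning
        capacity : future o H (suc t) ≤ load A α∞ t + H
        capacity = begin
          H * o t + F t                  ≡⟨ cong (_+ F t) (trans (*-comm H (o t)) (cong (_* H) (o-unfold t))) ⟩
          rule α o t * H + F t           ≤⟨ +-monoˡ-≤ (F t) (m/n*n≤m (due α o t ∸ F t + H′) H) ⟩
          due α o t ∸ F t + H′ + F t     ≡⟨ swap (due α o t ∸ F t) H′ (F t) ⟩
          due α o t ∸ F t + F t + H′     ≡⟨ cong (_+ H′) (m∸n+n≡m (<⇒≤ (opened⇒due t opened))) ⟩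
          due α o t + H′                 ≤⟨ +-mono-≤ (+-mono-≤ (backlog-mono A (λ s → α≤α∞ s (t + H)) t) (α≤α∞ t (t + H))) (n≤1+n H′) ⟩
          load A α∞ t + H                ∎
          where
          swap : ∀ a b c → a + b + c ≡ a + c + b
          swap = solve-∀
        eq : ∀ f w w′ l h x a → f + (w + w′) + (l + h + (x + a)) + 0 ≡ (a + f) + (l + w′) + (x + h + w)
        eq = solve-∀
        balance : F (suc t) + W (suc t) ≤ X (suc t) + H + W t
        balance = ≤-linear 0 (+-mono-≤ (≤-trans (≤-reflexive (sym (future-step o H′ (suc t)))) capacity)
                                       (≤-reflexive (sym (conservation t))))
          (eq (F (suc t)) (W t) (waste t) (load A α∞ t) H (X (suc t)) (A t))

      arrived-since : ∀ β y t → backlog A β (suc y) ≡ 0 → y < t → 1 ≤ load A β t → ∃ λ s → y < s × s ≤ t × 1 ≤ β s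
      arrived-since β y (suc t) empty (s≤s y≤t) some with β (suc t) ≟ 0
      ... | no  β≢0 = suc t , s≤s y≤t , ≤-refl , n≢0⇒n>0 β≢0
      ... | yes β≡0 with m≤n⇒m<n∨m≡n y≤t
      ...   | inj₂ refl = contradiction (≤-trans some (≤-reflexive (cong₂ _+_ empty β≡0))) λ()
      ...   | inj₁ y<t with arrived-since β y t empty y<t (≤-trans (≤-trans some (≤-reflexive (trans (cong (backlog A β (suc t) +_) β≡0) (+-identityʳ _)))) (m∸n≤m _ (A t)))
      ...     | s , y<s , s≤t , β≥1 = s , y<s , m≤n⇒m≤1+n s≤t , β≥1

      -- If slots were wasted since `z`, the queue was empty at some time after `z`, so a job due by
      -- `t + H` arrived later still. For such a job `cover` pays `suc k ⊓ H`, which is all that can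
      -- have been wasted.
      stage-paid : ∀ {t} → Stage t → 1 ≤ o t → W t ≤ C t
      stage-paid {t} st opened-t with Stage.idle st
      ... | inj₁ same = ≤-trans (≤-reflexive same) (≤-trans (Stage.paid st)
        (sumTo-monoʳ cov (subst (Stage.z st ≤_) (sym (Stage.t≡ st)) (m≤n+m _ _))))
      ... | inj₂ (y , z≤y , y<t , empty) = begin
        W t                                          ≤⟨ wasted ⟩
        W z + suc k ⊓ H                              ≤⟨ +-mono-≤ paid (cover z (suc k) s (≤-<-trans z≤y y<s) (subst (s ≤_) t≡ s≤t) (subst (λ x → 1 ≤ α s (x + H)) t≡ α≥1)) ⟩
        C z + sumTo (λ i → cov (z + i)) (suc k)      ≡⟨ sumTo-split cov z (suc k) ⟨
        C (z + suc k)                                ≡⟨ cong C (trans (+-comm z (suc k)) (sym t≡)) ⟩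
        C t                                          ∎
        where
        open Stage st
        open ≤-Reasoning
        arrival = arrived-since (λ s → α s (t + H)) y t
          (n≤0⇒n≡0 (≤-trans (backlog-mono A (λ s → α≤α∞ s (t + H)) (suc y)) (≤-reflexive empty)))
          y<t (≤-trans (s≤s z≤n) (opened⇒due t opened-t))
        s   = proj₁ arrival
        y<s = proj₁ (proj₂ arrival)
        s≤t = proj₁ (proj₂ (proj₂ arrival))
        α≥1 = proj₂ (proj₂ (proj₂ arrival))

      stage-step : ∀ {t} → Stage t → Stage (suc t)
      stage-step {t} st with o t ≟ 0
      ... | no  o≢0 = open-stage t (n≢0⇒n>0 o≢0) (stage-paid st (n≢0⇒n>0 o≢0))
      ... | yes o≡0 = advance z (suc k) (cong suc t≡) opened paid
        (≤-linear (α∞ t) (+-mono-≤ balance (≤-reflexive (cong₂ _+_ remaining (sym (conservation t)))))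
          (eq (F (suc t)) (W t) (waste t) (X t) (α∞ t) H (W z) (A t) (F t) (X (suc t))))
        (≤-trans wasted (+-monoʳ-≤ (W z) (⊓-monoˡ-≤ H (n≤1+n (suc k)))))
        idle
        where
        open Stage st
        remaining : A t + F (suc t) ≡ F t
        remaining = trans (sym (future-step o H′ (suc t))) (cong (_+ F t) (trans (cong (H *_) o≡0) (*-zeroʳ H)))
        eq : ∀ f′ w w′ x b h wz a f x′ →
          f′ + (w + w′) + (x + h + wz + (f + (x′ + a))) + b ≡ f + w + (a + f′ + (x + b + w′)) + (x′ + h + wz)
        eq = solve-∀

      stage-or-unopened : ∀ t → (W t ≡ 0 × sumTo o t ≡ 0) ⊎ Stage t
      stage-or-unopened zero = inj₁ (refl , refl)
      stage-or-unopened (suc t) with stage-or-unopened t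
      ... | inj₂ st = inj₂ (stage-step st)
      ... | inj₁ (W≡0 , S≡0) with o t ≟ 0
      ...   | no  o≢0 = inj₂ (open-stage t (n≢0⇒n>0 o≢0) (≤-trans (≤-reflexive W≡0) z≤n))
      ...   | yes o≡0 = inj₁ (cong₂ _+_ W≡0 (trans (cong (_∸ load A α∞ t) closed) (0∸n≡0 (load A α∞ t))) , S≡0′)
        where
        S≡0′ : sumTo o (suc t) ≡ 0
        S≡0′ = cong₂ _+_ S≡0 o≡0
        closed : A t ≡ 0
        closed = n≤0⇒n≡0 (≤-trans (window≤sumTo o H (suc t)) (≤-reflexive S≡0′))

      total-capacity : ∀ n → H * sumTo o n ≡ sumTo A n + F n
      total-capacity zero = trans (*-zeroʳ H) (sym (F0 H′))
        where
        F0 : ∀ l → future o l 0 ≡ 0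
        F0 zero    = refl
        F0 (suc l) = refl
      total-capacity (suc n) = begin
        H * (sumTo o n + o n)                       ≡⟨ *-distribˡ-+ H (sumTo o n) (o n) ⟩
        H * sumTo o n + H * o n                     ≡⟨ cong (_+ H * o n) (total-capacity n) ⟩
        sumTo A n + F n + H * o n                   ≡⟨ eq (sumTo A n) (F n) (H * o n) ⟩
        sumTo A n + future o H (suc n)              ≡⟨ cong (sumTo A n +_) (future-step o H′ (suc n)) ⟩
        sumTo A n + (A n + F (suc n))               ≡⟨ +-assoc (sumTo A n) (A n) _ ⟨
        sumTo A n + A n + F (suc n)                 ∎
        where
        open ≡-Reasoning
        eq : ∀ a f x → a + f + x ≡ a + (x + f)
        eq = solve-∀

      total-work : ∀ n → X n + sumTo A n ≡ sumTo α∞ n + W n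
      total-work zero    = refl
      total-work (suc n) = +-cancelˡ-≡ (X n) _ _ (begin
        X n + (X (suc n) + (sumTo A n + A n))               ≡⟨ eq₁ (X n) (X (suc n)) (sumTo A n) (A n) ⟩
        X n + sumTo A n + (X (suc n) + A n)                 ≡⟨ cong₂ _+_ (total-work n) (conservation n) ⟩
        sumTo α∞ n + W n + (X n + α∞ n + waste n)           ≡⟨ eq₂ (sumTo α∞ n) (W n) (X n) (α∞ n) (waste n) ⟩
        X n + (sumTo α∞ n + α∞ n + (W n + waste n))         ∎)
        where
        open ≡-Reasoning
        eq₁ : ∀ a b c d → a + (b + (c + d)) ≡ a + c + (b + d)
        eq₁ = solve-∀
        eq₂ : ∀ a b c d e → a + b + (c + d + e) ≡ c + (a + d + (b + e))
        eq₂ = solve-∀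

      -- Capacity bought is work done, waste, or still ahead. `balance` trades the last part and the
      -- waste since `z` for pending work and one `H`; earlier waste is paid by `cov`.
      cost : ∀ n → H * sumTo o n ≤ sumTo α∞ n + H + sumTo cov n
      cost n with stage-or-unopened n
      ... | inj₁ (_ , S≡0) = ≤-trans (≤-reflexive (trans (cong (H *_) S≡0) (*-zeroʳ H))) z≤n
      ... | inj₂ st = ≤-linear 0
        (+-mono-≤ (≤-reflexive (total-capacity n)) (+-mono-≤ balance (+-mono-≤ (≤-reflexive (total-work n))
          (≤-trans paid (sumTo-monoʳ cov (subst (z ≤_) (sym t≡) (m≤n+m z (suc k))))))))
        (eq (H * sumTo o n) (sumTo A n) (F n) (X n) (W n) (W z) (sumTo α∞ n) (C n) H)
        where
        open Stage st
        eq : ∀ s a f x w wz v c h →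
          s + (a + f + (x + h + wz + (v + w + c))) + 0 ≡ s + (f + w + (x + a + wz)) + (v + h + c)
        eq = solve-∀

maxTo : (ℕ → ℕ) → ℕ → ℕ
maxTo f zero    = 0
maxTo f (suc n) = maxTo f n ⊔ f n

maxTo-cong : ∀ {f g} n → (∀ i → f i ≡ g i) → maxTo f n ≡ maxTo g n
maxTo-cong zero    eq = refl
maxTo-cong (suc n) eq = cong₂ _⊔_ (maxTo-cong n eq) (eq n)

≤-maxTo : ∀ f {i n} → i < n → f i ≤ maxTo f n
≤-maxTo f {i} {suc n} (s≤s i≤n) with m≤n⇒m<n∨m≡n i≤n
... | inj₁ i<n  = ≤-trans (≤-maxTo f i<n) (m≤m⊔n _ _)
... | inj₂ refl = m≤n⊔m (maxTo f n) _

maxTo-lub : ∀ f {b} n → (∀ i → i < n → f i ≤ b) → maxTo f n ≤ b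
maxTo-lub f zero    le = z≤n
maxTo-lub f (suc n) le = ⊔-lub (maxTo-lub f n λ i i<n → le i (m<n⇒m<1+n i<n)) (le n ≤-refl)

-- Jobs with short windows

module Short (h len′ : ℕ) where

  len : ℕ
  len = suc len′

  -- The known jobs whose windows lie in [t - u, t + u).
  centred : (ℕ → ℕ → ℕ) → ℕ → ℕ → ℕ
  centred α t u = sumTo (λ s → if t ≤ᵇ s + u then α s (t + u) else 0) (suc t)

  -- A lower bound for the calibrations needed around `t`: one of them has at most `2u` slots in [t
  -- - u, t + u). Here `u = suc v`, and `ceilDiv _ (v + suc v)` divides by `2u`.
  density : (ℕ → ℕ → ℕ) → ℕ → ℕ
  density α t = maxTo (λ v → ceilDiv (centred α t (suc v)) (v + suc v)) h

  -- The factor 4 is 2 · 2: the density refers to intervals of length `2u`, and a job collects its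
  -- credit in only half of its time.
  rule : (ℕ → ℕ → ℕ) → (ℕ → ℕ) → ℕ → ℕ
  rule α o t = 4 * density α t ∸ window o len′ t

  openings : (ℕ → ℕ → ℕ) → ℕ → ℕ
  openings α = causalFix (rule α)

  rule-causal : ∀ α → Causal (rule α)
  rule-causal α t eq = cong (4 * density α t ∸_) (window-cong len′ t eq)

  openings-unfold : ∀ α t → openings α t ≡ rule α (openings α) t
  openings-unfold α = causalFix-unfold (rule α) (rule-causal α)

  openings-cong : ∀ {α α′} n → (∀ s d → s < n → α s d ≡ α′ s d) → ∀ t → t < n → openings α t ≡ openings α′ t
  openings-cong {α} {α′} n agree = causalFix-cong (rule-causal α) (rule-causal α′) n λ o t t<n →
    cong (λ x → 4 * x ∸ window o len′ t) (maxTo-cong h λ v → cong (λ x → ceilDiv x (v + suc v))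
      (sumTo-cong (suc t) λ s s<1+t → cong (λ x → if t ≤ᵇ s + suc v then x else 0) (agree s _ (≤-trans s<1+t t<n))))

  centred≤density : ∀ α t {u} → 1 ≤ u → u ≤ h → centred α t u ≤ density α t * (u + u)
  centred≤density α t {suc v} _ v<h = ≤-trans (≤-ceilDiv (centred α t (suc v)) (v + suc v))
    (*-monoˡ-≤ (suc v + suc v) (≤-maxTo (λ v → ceilDiv (centred α t (suc v)) (v + suc v)) v<h))

  density-least : ∀ α t {b} → (∀ u → 1 ≤ u → u ≤ h → centred α t u ≤ b * (u + u)) → density α t ≤ b
  density-least α t le = maxTo-lub _ h λ v v<h → ceilDiv-least (v + suc v) (le (suc v) (s≤s z≤n) v<h)

  -- [c, c + len) meets [t - h, t + h), the widest interval entering the density at `t`.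
  touches : ℕ → ℕ → Bool
  touches t c = (c <ᵇ t + h) ∧ (t <ᵇ c + len + h)

  module _ (α : ℕ → ℕ → ℕ) (o : ℕ → ℕ) (o-unfold : ∀ t → o t ≡ rule α o t) where

    4density≤active : ∀ t → 4 * density α t ≤ active o len t
    4density≤active t = ≤-trans (m≤n+m∸n (4 * density α t) (window o len′ t))
      (≤-reflexive (trans (+-comm (window o len′ t) _) (cong (_+ window o len′ t) (sym (o-unfold t)))))

    -- K / u, where K = h ! is divisible by every u ≤ h.
    weight : ℕ → ℕ
    weight zero    = 0
    weight (suc v) = h ! / suc v

    weight-* : ∀ {u} → 1 ≤ u → u ≤ h → weight u * u ≡ h !
    weight-* {suc v} _ u≤h = m/n*n≡m (∣-trans (m∣m*n (v !)) (m≤n⇒m!∣n! u≤h))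

    weight-antitone : ∀ {u g} → 1 ≤ u → u ≤ g → weight g ≤ weight u
    weight-antitone {suc u} {suc g} _ u≤g = /-monoʳ-≤ (h !) u≤g

    module _ (mono : ∀ s {d d′} → d ≤ d′ → α s d ≤ α s d′) (short : ∀ s d → α s d ≤ α s (s + h)) (1≤h : 1 ≤ h) where

      -- Every job of [t₀, t₀ + n) is credited, during the first half of its
      -- time to t₀ + n (or to its release plus h, if that comes first), with the
      -- density at radius min (time left) h.  The credits add up to at least one.
      feasible⁺ : ∀ t₀ n →
        sumTo (λ k → α (t₀ + k) (t₀ + n)) n ≤ sumTo (λ i → active o len (t₀ + i)) n
      feasible⁺ t₀ n = *-cancelˡ-≤ (h !) {{h !≢0}} (begin
        h ! * sumTo κ n
          ≡⟨ sumTo-*ˡ (h !) κ n ⟨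
        sumTo (λ k → h ! * κ k) n
          ≤⟨ sumTo-mono n (λ k k<n → *-monoˡ-≤ (κ k) (credit k k<n)) ⟩
        sumTo (λ k → sumTo (λ i → share i k) n * κ k) n
          ≡⟨ sumTo-cong n (λ k _ → trans (*-comm _ (κ k)) (sym (sumTo-*ˡ (κ k) (λ i → share i k) n))) ⟩
        sumTo (λ k → sumTo (λ i → κ k * share i k) n) n
          ≡⟨ sumTo-swap (λ k i → κ k * share i k) n n ⟩
        sumTo (λ i → sumTo (λ k → κ k * share i k) n) n
          ≤⟨ sumTo-mono n charge ⟩
        sumTo (λ i → h ! * active o len (t₀ + i)) n
          ≡⟨ sumTo-*ˡ (h !) (λ i → active o len (t₀ + i)) n ⟩
        h ! * sumTo (λ i → active o len (t₀ + i)) n ∎)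
        where
        open ≤-Reasoning

        κ : ℕ → ℕ
        κ k = α (t₀ + k) (t₀ + n)

        radius : ℕ → ℕ
        radius i = (n ∸ i) ⊓ h

        seen : ℕ → ℕ → Bool
        seen i k = interval i (radius i) 1 k

        share : ℕ → ℕ → ℕ
        share i k = 2 * weight (radius i) * 𝟙 (seen i k)

        1≤radius : ∀ {i} → i < n → 1 ≤ radius i
        1≤radius i<n = ⊓-glb (m<n⇒0<n∸m i<n) 1≤h

        credit : ∀ k → k < n → h ! ≤ sumTo (λ i → share i k) n
        -- Each of the first `suc ⌊ g /2⌋` steps from the release on is worth at least twice K / g.
        credit k k<n = ≤-trans enough (sumTo-block≤ (2 * weight g) (λ i → share i k) k (suc ⌊ g /2⌋) inside each)
          where
          g = radius k
          1≤g = 1≤radius k<n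
          half : ∀ x → 1 ≤ x → suc ⌊ x /2⌋ ≤ x
          half (suc x) _ = ⌊n/2⌋<n x
          inside : k + suc ⌊ g /2⌋ ≤ n
          inside = ≤-trans (+-monoʳ-≤ k (≤-trans (half g 1≤g) (m⊓n≤m (n ∸ k) h))) (≤-reflexive (m+[n∸m]≡n (<⇒≤ k<n)))
          eq : ∀ a w → (a + suc a) * w + w + 0 ≡ suc a * (2 * w)
          eq = solve-∀
          enough : h ! ≤ suc ⌊ g /2⌋ * (2 * weight g)
          enough = begin
            h !                                                       ≡⟨ weight-* 1≤g (m⊓n≤n (n ∸ k) h) ⟨
            weight g * g                                              ≡⟨ *-comm (weight g) g ⟩
            g * weight g                                              ≤⟨ *-monoˡ-≤ (weight g) (≤-trans (≤-reflexive (sym (⌊n/2⌋+⌈n/2⌉≡n g))) (+-monoʳ-≤ ⌊ g /2⌋ (⌈n/2⌉≤1+⌊n/2⌋ g))) ⟩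
            (⌊ g /2⌋ + suc ⌊ g /2⌋) * weight g                        ≤⟨ ≤-trans (m≤m+n _ (weight g)) (m≤m+n _ 0) ⟩
            (⌊ g /2⌋ + suc ⌊ g /2⌋) * weight g + weight g + 0         ≡⟨ eq ⌊ g /2⌋ (weight g) ⟩
            suc ⌊ g /2⌋ * (2 * weight g)                              ∎
          each : ∀ e → e < suc ⌊ g /2⌋ → 2 * weight g ≤ share (k + e) k
          -- The radius shrinks with time, so the weight grows; twice `e` is at most `g`, which
          -- keeps the release within the radius.
          each e (s≤s e≤) = begin
            2 * weight g                                   ≤⟨ *-monoʳ-≤ 2 (weight-antitone (1≤radius i<n) shrink) ⟩
            2 * weight (radius (k + e))                    ≡⟨ *-identityʳ _ ⟨
            2 * weight (radius (k + e)) * 1                ≡⟨ cong (2 * weight (radius (k + e)) *_) (𝟙-true near) ⟨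
            share (k + e) k                                ∎
            where
            i<n : k + e < n
            i<n = ≤-trans (≤-reflexive (sym (+-suc k e))) (≤-trans (+-monoʳ-≤ k (s≤s e≤)) inside)
            shrink : radius (k + e) ≤ g
            shrink = ⊓-monoˡ-≤ h (∸-monoʳ-≤ n (m≤m+n k e))
            e+e≤g : e + e ≤ g
            e+e≤g = ≤-trans (+-mono-≤ e≤ e≤) (≤-trans (+-monoʳ-≤ ⌊ g /2⌋ (⌊n/2⌋≤⌈n/2⌉ g)) (≤-reflexive (⌊n/2⌋+⌈n/2⌉≡n g)))
            e≤radius : e ≤ radius (k + e)
            e≤radius = ⊓-glb
              (subst (e ≤_) (∸-+-assoc n k e) (m+n≤o⇒m≤o∸n e (≤-trans e+e≤g (m⊓n≤m (n ∸ k) h))))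
              (≤-trans (m≤m+n e e) (≤-trans e+e≤g (m⊓n≤n (n ∸ k) h)))
            near : T (seen (k + e) k)
            near = interval-intro {k + e} (+-monoʳ-≤ k e≤radius) (≤-trans (s≤s (m≤m+n k e)) (≤-reflexive (+-comm 1 (k + e))))

        charge : ∀ i → i < n → sumTo (λ k → κ k * share i k) n ≤ h ! * active o len (t₀ + i)
        charge i i<n = begin
          sumTo (λ k → κ k * share i k) n                              ≡⟨ sumTo-cong n (λ k _ → eq₁ (κ k) (weight u) (𝟙 (seen i k))) ⟩
          sumTo (λ k → 2 * weight u * (𝟙 (seen i k) * κ k)) n          ≡⟨ sumTo-*ˡ (2 * weight u) _ n ⟩
          2 * weight u * sumTo (λ k → 𝟙 (seen i k) * κ k) n            ≤⟨ *-monoʳ-≤ (2 * weight u) counted ⟩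
          2 * weight u * centred α (t₀ + i) u                          ≤⟨ *-monoʳ-≤ (2 * weight u) (centred≤density α (t₀ + i) (1≤radius i<n) (m⊓n≤n (n ∸ i) h)) ⟩
          2 * weight u * (density α (t₀ + i) * (u + u))                ≡⟨ eq₂ (weight u) u (density α (t₀ + i)) ⟩
          weight u * u * (4 * density α (t₀ + i))                      ≡⟨ cong (_* (4 * density α (t₀ + i))) (weight-* (1≤radius i<n) (m⊓n≤n (n ∸ i) h)) ⟩
          h ! * (4 * density α (t₀ + i))                               ≤⟨ *-monoʳ-≤ (h !) (4density≤active (t₀ + i)) ⟩
          h ! * active o len (t₀ + i)                                  ∎
          where
          u = radius i
          eq₁ : ∀ a w b → a * (2 * w * b) ≡ 2 * w * (b * a)
          eq₁ = solve-∀
          eq₂ : ∀ w u d → 2 * w * (d * (u + u)) ≡ w * u * (4 * d)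
          eq₂ = solve-∀

          known : ℕ → ℕ
          known s = if t₀ + i ≤ᵇ s + u then α s (t₀ + i + u) else 0

          -- Either the radius is the whole time left and `t₀ + i + u` is the deadline `t₀ + n`, or
          -- it is `h` and a short job is due within `h` of its release.
          reach : ∀ k → k ≤ i → κ k ≤ α (t₀ + k) (t₀ + i + u)
          reach k k≤i with ⊓-sel (n ∸ i) h
          ... | inj₁ e = mono (t₀ + k) (≤-reflexive (sym (trans (cong (t₀ + i +_) e)
            (trans (+-assoc t₀ i (n ∸ i)) (cong (t₀ +_) (m+[n∸m]≡n (<⇒≤ i<n)))))))
          ... | inj₂ e = ≤-trans (short (t₀ + k) (t₀ + n))
            (mono (t₀ + k) (≤-trans (+-monoˡ-≤ h (+-monoʳ-≤ t₀ k≤i)) (≤-reflexive (cong (t₀ + i +_) (sym e)))))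

          pointwise : ∀ k → 𝟙 (seen i k) * κ k ≤ known (t₀ + k)
          pointwise k with seen i k in eq
          ... | false = z≤n
          ... | true with interval-elim i u 1 k (subst T (sym eq) _)
          ...   | i≤k+u , k<i+1
            rewrite Equivalence.to T-≡ (≤⇒≤ᵇ (≤-trans (+-monoʳ-≤ t₀ i≤k+u) (≤-reflexive (sym (+-assoc t₀ k u))))) =
            ≤-trans (≤-reflexive (+-identityʳ (κ k))) (reach k (≤-pred (≤-trans k<i+1 (≤-reflexive (+-comm i 1)))))

          beyond : ∀ k → suc i ≤ k → 𝟙 (seen i k) * κ k ≡ 0
          beyond k i<k = cong (_* κ k) (𝟙-false {seen i k} λ s →
            <⇒≱ (proj₂ (interval-elim i u 1 k s)) (≤-trans (≤-reflexive (+-comm i 1)) i<k))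

          counted : sumTo (λ k → 𝟙 (seen i k) * κ k) n ≤ centred α (t₀ + i) u
          counted = begin
            sumTo (λ k → 𝟙 (seen i k) * κ k) n                ≤⟨ sumTo-truncate n beyond ⟩
            sumTo (λ k → 𝟙 (seen i k) * κ k) (suc i)          ≤⟨ sumTo-mono (suc i) (λ k _ → pointwise k) ⟩
            sumTo (λ k → known (t₀ + k)) (suc i)              ≤⟨ m≤n+m _ (sumTo known t₀) ⟩
            sumTo known t₀ + sumTo (λ k → known (t₀ + k)) (suc i) ≡⟨ sumTo-split known t₀ (suc i) ⟨
            sumTo known (t₀ + suc i)                          ≡⟨ cong (sumTo known) (+-suc t₀ i) ⟩
            sumTo known (suc (t₀ + i))                        ∎

    feasible : (∀ s {d d′} → d ≤ d′ → α s d ≤ α s d′) → (∀ s d → α s d ≤ α s (s + h)) → (∀ s → α s s ≡ 0) →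
      ∀ d → Hall (active o len) (λ s → α s d) d
    feasible mono short empty d t₀ n refl with 1 ≤? h
    ... | yes 1≤h = feasible⁺ mono short 1≤h t₀ n
    -- With `h = 0` a short job would be due at its own release, against `empty`.
    ... | no  1≰h = ≤-trans (≤-reflexive (trans (sumTo-cong n λ k _ → none (t₀ + k)) (sumTo-zero n))) z≤n
      where
      none : ∀ s → α s (t₀ + n) ≡ 0
      none s = n≤0⇒n≡0 (≤-trans (short s (t₀ + n)) (≤-reflexive
        (trans (cong (α s) (trans (cong (s +_) (n<1⇒n≡0 (≰⇒> 1≰h))) (+-identityʳ s))) (empty s))))

    module _ (h+h≤len : h + h ≤ len) (cs : List ℕ)
             (touched : ∀ t → density α t ≤ sumL (λ c → 𝟙 (touches t c)) cs) where

      -- An upper bound for the number of times s < n, pairwise at least len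
      -- apart, at which c is touched.
      hits : ℕ → ℕ → ℕ
      hits n c = 𝟙 (suc c <ᵇ n + h) + 𝟙 (suc (c + len) <ᵇ n + h)

      hits-mono : ∀ {m n} c → m ≤ n → hits m c ≤ hits n c
      hits-mono {m} {n} c m≤n = +-mono-≤ (later (suc c)) (later (suc (c + len)))
        where
        later : ∀ x → 𝟙 (x <ᵇ m + h) ≤ 𝟙 (x <ᵇ n + h)
        later x = 𝟙-mono {x <ᵇ m + h} λ e → <⇒<ᵇ (<-≤-trans (<ᵇ⇒< x (m + h) e) (+-monoˡ-≤ h m≤n))

      hits-new : ∀ t c → 𝟙 (touches t c) ≤ hits (suc t) c
      hits-new t c = ≤-trans (𝟙-mono {touches t c} {suc c <ᵇ suc t + h} (λ e → proj₁ (T-∧-elim e))) (m≤m+n _ _)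

      -- A touching calibration has passed its first threshold, and by `h + h ≤ len` it was still
      -- before the second one `len` steps ago. If it had passed the first one then, it has passed
      -- the second one now; either way the touch adds one.
      hits-step : ∀ t c → len ≤ suc t → 𝟙 (touches t c) + hits (t ∸ len′) c ≤ hits (suc t) c
      hits-step t c (s≤s len′≤t) with touches t c in eq
      ... | false = hits-mono c (m≤n⇒m≤1+n (m∸n≤m t len′))
      ... | true  = +-mono-≤ {1} first second
        where
        touch = T-∧-elim {c <ᵇ t + h} {t <ᵇ c + len + h} (subst T (sym eq) _)
        back : t ∸ len′ + len′ ≡ t
        back = m∸n+n≡m len′≤t
        first : 1 ≤ 𝟙 (suc c <ᵇ suc t + h)
        first = ≤-reflexive (sym (𝟙-true (proj₁ touch)))
        not-yet : 𝟙 (suc (c + len) <ᵇ t ∸ len′ + h) ≡ 0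
        not-yet = 𝟙-false {suc (c + len) <ᵇ t ∸ len′ + h} λ e → n≮n _ (≤-linear 1
          (+-mono-≤ (+-mono-≤ (<ᵇ⇒< (suc (c + len)) (t ∸ len′ + h) e) (<ᵇ⇒< t (c + len + h) (proj₂ touch)))
                    (+-mono-≤ h+h≤len (≤-reflexive back)))
          (eq₁ c len′ (t ∸ len′) h t))
          where
          eq₁ : ∀ c l x h t → suc (c + h + h) + (x + h + (c + suc l + h) + (suc l + t)) + 1
            ≡ suc (suc (c + suc l)) + suc t + (h + h + (x + l)) + (c + h + h)
          eq₁ = solve-∀
        second : hits (t ∸ len′) c ≤ 𝟙 (suc (c + len) <ᵇ suc t + h)
        second = begin
          hits (t ∸ len′) c                            ≡⟨ cong (𝟙 (suc c <ᵇ t ∸ len′ + h) +_) not-yet ⟩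
          𝟙 (suc c <ᵇ t ∸ len′ + h) + 0                ≡⟨ +-identityʳ _ ⟩
          𝟙 (suc c <ᵇ t ∸ len′ + h)                    ≤⟨ 𝟙-mono {suc c <ᵇ t ∸ len′ + h} (λ e → <⇒<ᵇ (≤-linear 0
            (+-mono-≤ (<ᵇ⇒< (suc c) (t ∸ len′ + h) e) (≤-reflexive back)) (eq₂ c len′ (t ∸ len′) h t))) ⟩
          𝟙 (suc (c + len) <ᵇ suc t + h)               ∎
          where
          open ≤-Reasoning
          eq₂ : ∀ c l x h t → suc (suc (c + suc l)) + (x + h + t) + 0 ≡ suc (suc c) + (x + l) + (suc t + h)
          eq₂ = solve-∀

      -- When something is opened the truncated subtraction is exact, and exactly 4 times the
      -- density is open.
      opened-at : ∀ t → o t ≢ 0 → window o len (suc t) ≤ 4 * sumL (λ c → 𝟙 (touches t c)) cs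
      opened-at t o≢0 = begin
        o t + window o len′ t                                           ≡⟨ cong (_+ window o len′ t) (o-unfold t) ⟩
        4 * density α t ∸ window o len′ t + window o len′ t             ≡⟨ m∸n+n≡m {4 * density α t} (<⇒≤ (m∸n≢0⇒n<m {4 * density α t} {window o len′ t} (subst (_≢ 0) (o-unfold t) o≢0))) ⟩
        4 * density α t                                                 ≤⟨ *-monoʳ-≤ 4 (touched t) ⟩
        4 * sumL (λ c → 𝟙 (touches t c)) cs                             ∎
        where open ≤-Reasoning

      -- The openings of the last len steps before (and including) an opening
      -- at t are paid for by the calibrations touching t.
      cost-hits : ∀ b n → n ≤ b → sumTo o n ≤ 4 * sumL (hits n) cs
      cost-hits b       zero    _         = z≤n
      cost-hits (suc b) (suc t) (s≤s t≤b) with o t ≟ 0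
      ... | yes o≡0 = begin
        sumTo o t + o t            ≡⟨ trans (cong (sumTo o t +_) o≡0) (+-identityʳ _) ⟩
        sumTo o t                  ≤⟨ cost-hits b t t≤b ⟩
        4 * sumL (hits t) cs       ≤⟨ *-monoʳ-≤ 4 (sumL-≤ (λ c → hits-mono c (n≤1+n t)) cs) ⟩
        4 * sumL (hits (suc t)) cs ∎
        where open ≤-Reasoning
      ... | no o≢0 with len ≤? suc t
      ...   | yes len≤ = begin
        sumTo o (suc t)                                                           ≡⟨ window-split o len (suc t) ⟩
        window o len (suc t) + sumTo o (t ∸ len′)                                 ≤⟨ +-mono-≤ (opened-at t o≢0) (cost-hits b (t ∸ len′) (≤-trans (m∸n≤m t len′) t≤b)) ⟩
        4 * sumL (λ c → 𝟙 (touches t c)) cs + 4 * sumL (hits (t ∸ len′)) cs       ≡⟨ *-distribˡ-+ 4 (sumL (λ c → 𝟙 (touches t c)) cs) (sumL (hits (t ∸ len′)) cs) ⟨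
        4 * (sumL (λ c → 𝟙 (touches t c)) cs + sumL (hits (t ∸ len′)) cs)         ≡⟨ cong (4 *_) (sumL-+ _ (hits (t ∸ len′)) cs) ⟨
        4 * sumL (λ c → 𝟙 (touches t c) + hits (t ∸ len′) c) cs                   ≤⟨ *-monoʳ-≤ 4 (sumL-≤ (λ c → hits-step t c len≤) cs) ⟩
        4 * sumL (hits (suc t)) cs                                                ∎
        where open ≤-Reasoning
      ...   | no len≰ = begin
        sumTo o (suc t)                                ≡⟨ window-split o len (suc t) ⟩
        window o len (suc t) + sumTo o (t ∸ len′)      ≡⟨ cong (λ n → window o len (suc t) + sumTo o n) (m≤n⇒m∸n≡0 (≤-pred (<⇒≤ (≰⇒> len≰)))) ⟩
        window o len (suc t) + 0                       ≡⟨ +-identityʳ _ ⟩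
        window o len (suc t)                           ≤⟨ opened-at t o≢0 ⟩
        4 * sumL (λ c → 𝟙 (touches t c)) cs            ≤⟨ *-monoʳ-≤ 4 (sumL-≤ (hits-new t) cs) ⟩
        4 * sumL (hits (suc t)) cs                     ∎
        where open ≤-Reasoning

      cost : ∀ n → sumTo o n ≤ 8 * length cs
      cost n = begin
        sumTo o n                    ≤⟨ cost-hits n n ≤-refl ⟩
        4 * sumL (hits n) cs         ≤⟨ *-monoʳ-≤ 4 (sumL-≤ (λ c → +-mono-≤ (𝟙≤1 (suc c <ᵇ n + h)) (𝟙≤1 (suc (c + len) <ᵇ n + h))) cs) ⟩
        4 * sumL (λ _ → 2) cs        ≡⟨ cong (4 *_) (sumL-const 2 cs) ⟩
        4 * (length cs * 2)          ≡⟨ eq (length cs) ⟩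
        8 * length cs                ∎
        where
        open ≤-Reasoning
        eq : ∀ k → 4 * (k * 2) ≡ 8 * k
        eq = solve-∀

-- Arrivals and priorities

arrivals : (Job → Bool) → List Job → ℕ → ℕ
arrivals p I s = sumL (λ j → 𝟙 (p j ∧ (rel j ≡ᵇ s))) I

𝟙-arrival-≢ : ∀ b r s → r ≢ s → 𝟙 (b ∧ (r ≡ᵇ s)) ≡ 0
𝟙-arrival-≢ b r s r≢s = 𝟙-false {b ∧ (r ≡ᵇ s)} λ e → r≢s (≡ᵇ⇒≡ r s (proj₂ (T-∧-elim {b} e)))

released-≰ : ∀ {t s} j → released t j ≡ false → s ≤ t → rel j ≢ s
released-≰ {t} j eq s≤t refl = subst T eq (≤⇒≤ᵇ s≤t)

arrivals-view : ∀ p {t s} → s ≤ t → ∀ I → arrivals p (view t I) s ≡ arrivals p I s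
arrivals-view p s≤t [] = refl
arrivals-view p {t} {s} s≤t (j ∷ I) with released t j in eq
... | true  = cong (_ +_) (arrivals-view p s≤t I)
... | false = trans (arrivals-view p s≤t I) (cong (_+ arrivals p I s) (sym (𝟙-arrival-≢ (p j) (rel j) s (released-≰ j eq s≤t))))

arrivals-mono : ∀ {p q} → (∀ j → T (p j) → T (q j)) → ∀ I s → arrivals p I s ≤ arrivals q I s
arrivals-mono {p} {q} p⇒q I s = sumL-≤ (λ j → 𝟙-mono {p j ∧ (rel j ≡ᵇ s)} λ e →
  let (pj , rj) = T-∧-elim {p j} e in T-∧-intro (p⇒q j pj) rj) I

arrivals-cong : ∀ {p q} → (∀ j → p j ≡ q j) → ∀ I s → arrivals p I s ≡ arrivals q I s
arrivals-cong eq I s = sumL-cong (λ j → cong (λ b → 𝟙 (b ∧ (rel j ≡ᵇ s))) (eq j)) I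

module EDF (due : Job → ℕ) where

  upTo before : ℕ → Job → Bool
  upTo   d j = due j ≤ᵇ d
  before d j = due j <ᵇ d

  -- Ties are broken by the position in the input, of which pre is the part
  -- before j and post the part after it.
  prior : (pre post : List Job) → Job → ℕ → ℕ
  prior pre post j s = arrivals (upTo (due j)) pre s + arrivals (before (due j)) post s

  runs : (A : ℕ → ℕ) (t : ℕ) (pre post : List Job) → List Bool
  runs A t pre []         = []
  runs A t pre (j ∷ post) = runsAt A (prior pre post j) (rel j) t ∷ runs A t (j ∷ pre) post

  runsJob : (A : ℕ → ℕ) (t : ℕ) (pre post : List Job) → Fin (length post) → Bool
  runsJob A t pre (j ∷ post) zero    = runsAt A (prior pre post j) (rel j) t
  runsJob A t pre (j ∷ post) (suc i) = runsJob A t (j ∷ pre) post i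

  runsAt-cong : ∀ {A B β γ} r u → (∀ s → s ≤ u → A s ≡ B s) → (∀ s → s ≤ u → β s ≡ γ s) →
    runsAt A β r u ≡ runsAt B γ r u
  runsAt-cong {A} {B} {β} {γ} r u eqA eqβ = cong₂ (λ b c → not b ∧ c)
    (cong₂ _≡ᵇ_ (same-load eqβ⁺) (same-load eqβ))
    (cong₂ _≡ᵇ_ (cong₂ _∸_ (same-load eqβ⁺) (eqA u ≤-refl)) (cong₂ _∸_ (same-load eqβ) (eqA u ≤-refl)))
    where
    eqβ⁺ : ∀ s → s ≤ u → withJob β r s ≡ withJob γ r s
    eqβ⁺ s s≤u = cong (_+ 𝟙 (r ≡ᵇ s)) (eqβ s s≤u)
    same-load : ∀ {δ ε} → (∀ s → s ≤ u → δ s ≡ ε s) → load A δ u ≡ load B ε u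
    same-load eq = cong₂ _+_ (backlog-cong u (λ s s<u → eqA s (<⇒≤ s<u)) λ s s<u → eq s (<⇒≤ s<u)) (eq u ≤-refl)

  -- Jobs missing from the view shift positions, but they add no arrivals up to `u`, so no priority
  -- changes, and they cannot run before their release. `pre` and `pre′` are the traversed parts of
  -- the view and of the instance.
  marked-runs : ∀ {A B t u} → u ≤ t → (∀ s → s ≤ u → A s ≡ B s) → ∀ pre pre′ →
    (∀ p s → s ≤ u → arrivals p pre s ≡ arrivals p pre′ s) → ∀ post i →
    marked t post (runs A u pre (view t post)) i ≡ runsJob B u pre′ post i
  marked-runs {A} {B} {t} {u} u≤t eqA pre pre′ eq (j ∷ post) zero with released t j in rel-eq
  ... | true = runsAt-cong (rel j) u eqA λ s s≤u → cong₂ _+_ (eq _ s s≤u) (arrivals-view _ (≤-trans s≤u u≤t) post)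
  ... | false with runsAt B (prior pre′ post j) (rel j) u in run
  ...   | false = refl
  ...   | true  = contradiction (≤⇒≤ᵇ (≤-trans (runs⇒released B (prior pre′ post j) (rel j) u (subst T (sym run) _)) u≤t)) (subst T rel-eq)
  marked-runs {t = t} u≤t eqA pre pre′ eq (j ∷ post) (suc i) with released t j in rel-eq
  ... | true = marked-runs u≤t eqA (j ∷ pre) (j ∷ pre′) (λ p s s≤u → cong (𝟙 (p j ∧ (rel j ≡ᵇ s)) +_) (eq p s s≤u)) post i
  ... | false = marked-runs u≤t eqA pre (j ∷ pre′) (λ p s s≤u → trans (eq p s s≤u)
    (cong (_+ arrivals p pre′ s) (sym (𝟙-arrival-≢ (p j) (rel j) s (released-≰ j rel-eq (≤-trans s≤u u≤t)))))) post i

  marked-[] : ∀ t I i → marked t I [] i ≡ false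
  marked-[] t (j ∷ I) zero with released t j
  ... | true  = refl
  ... | false = refl
  marked-[] t (j ∷ I) (suc i) with released t j
  ... | true  = marked-[] t I i
  ... | false = marked-[] t I i

  -- The job and its competitors are all due no later than the job, so Hall's condition for its own
  -- deadline gets it done in time.
  runsJob-prior : ∀ pre post i → ∃ λ β →
    (∀ A t → runsJob A t pre post i ≡ runsAt A β (rel (lookup post i)) t) ×
    (∀ s → withJob β (rel (lookup post i)) s ≤
           arrivals (upTo (due (lookup post i))) pre s + arrivals (upTo (due (lookup post i))) post s)
  runsJob-prior pre (j ∷ post) zero = prior pre post j , (λ _ _ → refl) , bound
    where
    shuffle : ∀ a b c → a + b + c ≡ a + (c + b)
    shuffle = solve-∀
    bound : ∀ s → withJob (prior pre post j) (rel j) s ≤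
                  arrivals (upTo (due j)) pre s + arrivals (upTo (due j)) (j ∷ post) s
    bound s = ≤-trans (≤-reflexive (shuffle (arrivals (upTo (due j)) pre s) (arrivals (before (due j)) post s) (𝟙 (rel j ≡ᵇ s))))
      (+-monoʳ-≤ (arrivals (upTo (due j)) pre s) (+-mono-≤
        (𝟙-mono {rel j ≡ᵇ s} λ e → T-∧-intro (≤⇒≤ᵇ (≤-refl {due j})) e)
        (arrivals-mono (λ k e → ≤⇒≤ᵇ (<⇒≤ (<ᵇ⇒< (due k) (due j) e))) post s)))
  runsJob-prior pre (j ∷ post) (suc i) with runsJob-prior (j ∷ pre) post i
  ... | β , same , bound = β , same , λ s → ≤-trans (bound s) (≤-reflexive
      (shuffle (𝟙 (upTo (due (lookup post i)) j ∧ (rel j ≡ᵇ s))) (arrivals (upTo (due (lookup post i))) pre s) (arrivals (upTo (due (lookup post i))) post s)))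
    where
    shuffle : ∀ a b c → a + b + c ≡ b + (a + c)
    shuffle = solve-∀

  countRuns : (ℕ → ℕ) → ℕ → (Job → Bool) → (pre post : List Job) → ℕ
  countRuns A t q pre []         = 0
  countRuns A t q pre (j ∷ post) = 𝟙 (q j ∧ runsAt A (prior pre post j) (rel j) t) + countRuns A t q (j ∷ pre) post

  module _ (A : ℕ → ℕ) (t : ℕ) where

    served : (ℕ → ℕ) → ℕ
    served β = load A β t ⊓ A t

    served-cong : ∀ {β γ} → (∀ s → β s ≡ γ s) → served β ≡ served γ
    served-cong eq = cong (_⊓ A t) (cong₂ _+_ (backlog-cong t (λ _ _ → refl) λ s _ → eq s) (eq t))

    -- Jobs with deadline `d` join the stream one by one in input order; by `runs-served` each of
    -- them that runs raises the number served.
    countRuns-at : ∀ d pre post →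
      countRuns A t (λ j → due j ≡ᵇ d) pre post + served (λ s → arrivals (upTo d) pre s + arrivals (before d) post s)
        ≤ served (λ s → arrivals (upTo d) pre s + arrivals (upTo d) post s)
    countRuns-at d pre []         = ≤-refl
    countRuns-at d pre (j ∷ post) with due j ≟ d
    ... | yes refl = begin
      𝟙 ((due j ≡ᵇ d) ∧ run) + rest + served (λ s → arrivals (upTo d) pre s + arrivals (before d) (j ∷ post) s)
        ≡⟨ cong₂ (λ b x → 𝟙 (b ∧ run) + rest + x) (Equivalence.to T-≡ (≡⇒≡ᵇ (due j) (due j) refl))
             (served-cong λ s → cong (λ b → arrivals (upTo d) pre s + (𝟙 (b ∧ (rel j ≡ᵇ s)) + arrivals (before d) post s)) (<ᵇ-irrefl d)) ⟩
      𝟙 run + rest + served β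
        ≡⟨ shuffle (𝟙 run) rest (served β) ⟩
      rest + (𝟙 run + served β)
        ≤⟨ +-monoʳ-≤ rest (runs-served A β (rel j) t) ⟩
      rest + served (withJob β (rel j))
        ≡⟨ cong (rest +_) (served-cong moved) ⟩
      rest + served (λ s → arrivals (upTo d) (j ∷ pre) s + arrivals (before d) post s)
        ≤⟨ countRuns-at d (j ∷ pre) post ⟩
      served (λ s → arrivals (upTo d) (j ∷ pre) s + arrivals (upTo d) post s)
        ≡⟨ served-cong (λ s → shuffle (𝟙 (upTo d j ∧ (rel j ≡ᵇ s))) (arrivals (upTo d) pre s) (arrivals (upTo d) post s)) ⟩
      served (λ s → arrivals (upTo d) pre s + arrivals (upTo d) (j ∷ post) s) ∎
      where
      open ≤-Reasoning
      β    = prior pre post j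
      run  = runsAt A β (rel j) t
      rest = countRuns A t (λ k → due k ≡ᵇ d) (j ∷ pre) post
      <ᵇ-irrefl : ∀ n → (n <ᵇ n) ≡ false
      <ᵇ-irrefl zero    = refl
      <ᵇ-irrefl (suc n) = <ᵇ-irrefl n
      shuffle : ∀ a b c → a + b + c ≡ b + (a + c)
      shuffle = solve-∀
      shuffle′ : ∀ a b c → a + b + c ≡ c + a + b
      shuffle′ = solve-∀
      moved : ∀ s → withJob β (rel j) s ≡ arrivals (upTo d) (j ∷ pre) s + arrivals (before d) post s
      moved s = trans (shuffle′ (arrivals (upTo d) pre s) (arrivals (before d) post s) (𝟙 (rel j ≡ᵇ s)))
        (cong (λ b → 𝟙 (b ∧ (rel j ≡ᵇ s)) + arrivals (upTo d) pre s + arrivals (before d) post s)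
              (sym (Equivalence.to T-≡ (≤⇒≤ᵇ (≤-refl {d})))))
    ... | no j≢d = begin
      𝟙 ((due j ≡ᵇ d) ∧ run) + rest + served (λ s → arrivals (upTo d) pre s + arrivals (before d) (j ∷ post) s)
        ≡⟨ cong₂ _+_ (cong (_+ rest) (𝟙-false {(due j ≡ᵇ d) ∧ run} λ e → j≢d (≡ᵇ⇒≡ _ _ (proj₁ (T-∧-elim e)))))
             (served-cong moved) ⟩
      rest + served (λ s → arrivals (upTo d) (j ∷ pre) s + arrivals (before d) post s)
        ≤⟨ countRuns-at d (j ∷ pre) post ⟩
      served (λ s → arrivals (upTo d) (j ∷ pre) s + arrivals (upTo d) post s)
        ≡⟨ served-cong (λ s → shuffle (𝟙 (upTo d j ∧ (rel j ≡ᵇ s))) (arrivals (upTo d) pre s) (arrivals (upTo d) post s)) ⟩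
      served (λ s → arrivals (upTo d) pre s + arrivals (upTo d) (j ∷ post) s) ∎
      where
      open ≤-Reasoning
      run  = runsAt A (prior pre post j) (rel j) t
      rest = countRuns A t (λ k → due k ≡ᵇ d) (j ∷ pre) post
      shuffle : ∀ a b c → a + b + c ≡ b + (a + c)
      shuffle = solve-∀
      ≤ᵇ≡<ᵇ : ∀ m n → m ≢ n → (m ≤ᵇ n) ≡ (m <ᵇ n)
      ≤ᵇ≡<ᵇ zero    zero    m≢n = contradiction refl m≢n
      ≤ᵇ≡<ᵇ zero    (suc n) m≢n = refl
      ≤ᵇ≡<ᵇ (suc m) zero    m≢n = refl
      ≤ᵇ≡<ᵇ (suc zero)    (suc n) m≢n = ≤ᵇ≡<ᵇ zero n λ e → m≢n (cong suc e)
      ≤ᵇ≡<ᵇ (suc (suc m)) (suc n) m≢n = ≤ᵇ≡<ᵇ (suc m) n λ e → m≢n (cong suc e)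
      moved : ∀ s → arrivals (upTo d) pre s + arrivals (before d) (j ∷ post) s
                  ≡ arrivals (upTo d) (j ∷ pre) s + arrivals (before d) post s
      moved s = trans (cong (λ b → arrivals (upTo d) pre s + (𝟙 (b ∧ (rel j ≡ᵇ s)) + arrivals (before d) post s)) (sym (≤ᵇ≡<ᵇ (due j) d j≢d)))
        (sym (shuffle (𝟙 (upTo d j ∧ (rel j ≡ᵇ s))) (arrivals (upTo d) pre s) (arrivals (before d) post s)))

    countRuns-suc : ∀ d pre post → countRuns A t (before (suc d)) pre post
      ≤ countRuns A t (before d) pre post + countRuns A t (λ j → due j ≡ᵇ d) pre post
    countRuns-suc d pre []         = z≤n
    countRuns-suc d pre (j ∷ post) = ≤-trans (+-mono-≤ (split (due j) run) (countRuns-suc d (j ∷ pre) post))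
      (≤-reflexive (+-interchange (𝟙 (before d j ∧ run)) (𝟙 ((due j ≡ᵇ d) ∧ run)) _ _))
      where
      run = runsAt A (prior pre post j) (rel j) t
      split : ∀ n r → 𝟙 ((n <ᵇ suc d) ∧ r) ≤ 𝟙 ((n <ᵇ d) ∧ r) + 𝟙 ((n ≡ᵇ d) ∧ r)
      split n r with n <ᵇ suc d in lt
      ... | false = z≤n
      ... | true with m≤n⇒m<n∨m≡n (≤-pred (<ᵇ⇒< n (suc d) (subst T (sym lt) _)))
      ...   | inj₁ n<d rewrite Equivalence.to T-≡ (<⇒<ᵇ n<d) = m≤m+n (𝟙 r) _
      ...   | inj₂ refl rewrite Equivalence.to T-≡ (≡⇒≡ᵇ n n refl) = m≤n+m (𝟙 r) _

    countRuns-before : ∀ d I → countRuns A t (before d) [] I ≤ served (arrivals (before d) I)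
    countRuns-before zero    I = ≤-trans (none [] I) z≤n
      where
      none : ∀ pre post → countRuns A t (before 0) pre post ≤ 0
      none pre []         = z≤n
      none pre (j ∷ post) = none (j ∷ pre) post
    countRuns-before (suc d) I = begin
      countRuns A t (before (suc d)) [] I                                               ≤⟨ countRuns-suc d [] I ⟩
      countRuns A t (before d) [] I + countRuns A t (λ j → due j ≡ᵇ d) [] I             ≤⟨ +-monoˡ-≤ _ (countRuns-before d I) ⟩
      served (arrivals (before d) I) + countRuns A t (λ j → due j ≡ᵇ d) [] I            ≡⟨ +-comm (served (arrivals (before d) I)) _ ⟩
      countRuns A t (λ j → due j ≡ᵇ d) [] I + served (arrivals (before d) I)            ≤⟨ countRuns-at d [] I ⟩
      served (arrivals (upTo d) I)                                                      ≡⟨ served-cong (arrivals-cong (λ j → sym (<ᵇ-suc (due j) d)) I) ⟩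
      served (arrivals (before (suc d)) I)                                              ∎
      where
      open ≤-Reasoning
      <ᵇ-suc : ∀ m n → (m <ᵇ suc n) ≡ (m ≤ᵇ n)
      <ᵇ-suc zero    n = refl
      <ᵇ-suc (suc m) n = refl

    #true-runsJob : ∀ pre post → #true (length post) (runsJob A t pre post) ≡ countRuns A t (λ _ → true) pre post
    #true-runsJob pre []         = refl
    #true-runsJob pre (j ∷ post) = cong (𝟙 (runsAt A (prior pre post j) (rel j) t) +_) (#true-runsJob (j ∷ pre) post)

    countRuns-all : ∀ d pre post → sumL due post < d → countRuns A t (λ _ → true) pre post ≤ countRuns A t (before d) pre post
    countRuns-all d pre []         lt = z≤n
    countRuns-all d pre (j ∷ post) lt = +-mono-≤
      (𝟙-mono {runsAt A (prior pre post j) (rel j) t} λ e → T-∧-intro (<⇒<ᵇ (≤-<-trans (m≤m+n (due j) _) lt)) e)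
      (countRuns-all d (j ∷ pre) post (≤-<-trans (m≤n+m _ (due j)) lt))

    runsJob≤capacity : ∀ I → #true (length I) (runsJob A t [] I) ≤ A t
    runsJob≤capacity I = begin
      #true (length I) (runsJob A t [] I)         ≡⟨ #true-runsJob [] I ⟩
      countRuns A t (λ _ → true) [] I             ≤⟨ countRuns-all d [] I ≤-refl ⟩
      countRuns A t (before d) [] I               ≤⟨ countRuns-before d I ⟩
      served (arrivals (before d) I)              ≤⟨ m⊓n≤n _ (A t) ⟩
      A t                                         ∎
      where
      open ≤-Reasoning
      -- Any value above all deadlines would do.
      d = suc (sumL due I)

-- From openings to an online algorithm

-- Since a calibration is usable act steps after its start, everything planned
-- for time t is carried out at time t + act, and a deadline d turns into d ∸ act.
module Online (act len : ℕ) (openings : List Job → ℕ → ℕ)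
              (openings-view : ∀ I {t s} → s ≤ t → openings (view t I) s ≡ openings I s) where

  due : Job → ℕ
  due j = dl j ∸ act

  open EDF due

  capacity : List Job → ℕ → ℕ
  capacity I = active (openings I) len

  -- The jobs planned for `t ∸ act` are computed from the larger view at `t`; those released after
  -- `t ∸ act` do not enter that plan.
  alg : OnlineAlg
  alg t J = openings J t , (if act ≤ᵇ t then runs (capacity J) (t ∸ act) [] J else [])

  algCal≡ : ∀ I t → algCal alg I t ≡ openings I t
  algCal≡ I t = openings-view I ≤-refl

  algRuns≡ : ∀ I t i → algRuns alg I (t + act) i ≡ runsJob (capacity I) t [] I i
  algRuns≡ I t i rewrite Equivalence.to T-≡ (≤⇒≤ᵇ (m≤n+m act t)) | m+n∸n≡m t act =
    marked-runs (m≤m+n t act) (λ s s≤t → window-cong len (suc s) λ u u<1+s →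
      openings-view I (≤-trans (≤-pred u<1+s) (≤-trans s≤t (m≤m+n t act)))) [] [] (λ _ _ _ → refl) I i

  algRuns-early : ∀ I t i → t < act → algRuns alg I t i ≡ false
  algRuns-early I t i t<act with act ≤ᵇ t in eq
  ... | true  = contradiction (≤ᵇ⇒≤ act t (subst T (sym eq) _)) (<⇒≱ t<act)
  ... | false = marked-[] t I i

  capacity≤active : ∀ I t → capacity I t ≤ algActive act len alg I (t + act)
  capacity≤active I t = begin
    window (openings I) len (suc t)
      ≡⟨ window-sumTo (openings I) len (suc t) ⟨
    sumTo (λ s → if suc t ≤ᵇ s + len then openings I s else 0) (suc t)
      ≤⟨ sumTo-mono (suc t) usable ⟩
    sumTo (λ s → if calibratedAt act len s (t + act) then algCal alg I s else 0) (suc t)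
      ≤⟨ sumTo-monoʳ _ (s≤s (m≤m+n t act)) ⟩
    algActive act len alg I (t + act) ∎
    where
    open ≤-Reasoning
    eq : ∀ t a s l → suc (t + a) + (s + l) + 0 ≡ suc t + (s + a + l)
    eq = solve-∀
    usable : ∀ s → s < suc t → (if suc t ≤ᵇ s + len then openings I s else 0)
                             ≤ (if calibratedAt act len s (t + act) then algCal alg I s else 0)
    usable s s<1+t with suc t ≤ᵇ s + len in lt
    ... | false = z≤n
    ... | true rewrite Equivalence.to (T-≡ {calibratedAt act len s (t + act)}) (T-∧-intro
      (≤⇒≤ᵇ (+-monoˡ-≤ act (≤-pred s<1+t)))
      (<⇒<ᵇ (≤-linear 0 (≤ᵇ⇒≤ (suc t) (s + len) (subst T (sym lt) _)) (eq t act s len)))) =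
      ≤-reflexive (sym (algCal≡ I s))

  due-valid : ∀ {j} → ValidJob act j → rel j < due j
  due-valid {j} valid = m+n≤o⇒m≤o∸n (suc (rel j)) (≤-trans (≤-reflexive (sym (+-suc (rel j) act))) valid)

  job-served : ∀ {I} → ValidInstance act I → (∀ d → Hall (capacity I) (arrivals (upTo d) I) d) → ∀ i →
    Σ ℕ (λ t → (algRuns alg I t i ≡ true)
             × (rel (lookup I i) ≤ t)
             × (t + 1 ≤ dl (lookup I i))
             × (∀ t′ → algRuns alg I t′ i ≡ true → t′ ≡ t))
  job-served {I} valid hall i = t + act ,
    trans (algRuns≡ I t i) (trans (same (capacity I) t) (Equivalence.to T-≡ run)) ,
    ≤-trans (runs⇒released (capacity I) β r t run) (m≤m+n t act) ,
    in-time , unique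
    where
    j = lookup I i
    r = rel j
    β    = proj₁ (runsJob-prior [] I i)
    same = proj₁ (proj₂ (runsJob-prior [] I i))
    bound = proj₂ (proj₂ (runsJob-prior [] I i))
    valid-j : ValidJob act j
    valid-j = All.lookup valid (∈-lookup i)
    finished : backlog (capacity I) (withJob β r) (due j) ≡ 0
    finished = n≤0⇒n≡0 (≤-trans (backlog-mono (capacity I) bound (due j))
      (≤-reflexive (Hall⇒backlog≡0 (hall (due j)))))
    found = runs-exists (capacity I) β r (due-valid {j} valid-j) finished
    t   = proj₁ found
    run = proj₁ (proj₂ found)
    in-time : t + act + 1 ≤ dl j
    in-time = ≤-trans (≤-reflexive (+-comm (t + act) 1)) (m≤o∸n⇒m+n≤o (suc t)
      (≤-trans (≤-trans (n≤1+n act) (m≤n+m (suc act) r)) valid-j) (proj₂ (proj₂ found)))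
    unique : ∀ t′ → algRuns alg I t′ i ≡ true → t′ ≡ t + act
    unique t′ runs′ with act ≤? t′
    ... | no  early = contradiction (trans (sym runs′) (algRuns-early I t′ i (≰⇒> early))) λ()
    ... | yes act≤t′ = trans (sym (m∸n+n≡m act≤t′)) (cong (_+ act) (runs-unique (capacity I) β r run
      (Equivalence.from T-≡ (trans (sym (same (capacity I) (t′ ∸ act))) (trans (sym (algRuns≡ I (t′ ∸ act) i))
        (trans (cong (λ x → algRuns alg I x i) (m∸n+n≡m act≤t′)) runs′))))))

  #true-cong : ∀ n {f g : Fin n → Bool} → (∀ i → f i ≡ g i) → #true n f ≡ #true n g
  #true-cong zero    eq = refl
  #true-cong (suc n) eq = cong₂ (λ b x → 𝟙 b + x) (eq zero) (#true-cong n (eq ∘ suc))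

  #true-false : ∀ n → #true n (λ _ → false) ≡ 0
  #true-false zero    = refl
  #true-false (suc n) = #true-false n

  slots-suffice : ∀ I t → #true (length I) (algRuns alg I t) ≤ algActive act len alg I t
  slots-suffice I t with act ≤? t
  ... | no  early = ≤-trans (≤-reflexive (trans (#true-cong (length I) λ i → algRuns-early I t i (≰⇒> early)) (#true-false (length I)))) z≤n
  ... | yes act≤t = subst (λ x → #true (length I) (algRuns alg I x) ≤ algActive act len alg I x) (m∸n+n≡m act≤t) (begin
    #true (length I) (algRuns alg I (u + act))      ≡⟨ #true-cong (length I) (algRuns≡ I u) ⟩
    #true (length I) (runsJob (capacity I) u [] I)  ≤⟨ runsJob≤capacity (capacity I) u I ⟩
    capacity I u                                    ≤⟨ capacity≤active I u ⟩
    algActive act len alg I (u + act)               ∎)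
    where
    open ≤-Reasoning
    u = t ∸ act

  feasible : ∀ I → ValidInstance act I → (∀ d → Hall (capacity I) (arrivals (upTo d) I) d) → AlgFeasible act len alg I
  feasible I valid hall = job-served valid hall , slots-suffice I

-- Short and long windows combined

module Algorithm (act len′ : ℕ) where

  h : ℕ
  h = ⌊ suc len′ /2⌋

  open Short h len′ using (len)
  open Long h using (H)

  h+h≤len : h + h ≤ len
  h+h≤len = ≤-trans (+-monoʳ-≤ h (⌊n/2⌋≤⌈n/2⌉ len)) (≤-reflexive (⌊n/2⌋+⌈n/2⌉≡n len))

  len≤H+H : len ≤ H + H
  len≤H+H = ≤-trans (≤-reflexive (sym (⌊n/2⌋+⌈n/2⌉≡n len))) (+-mono-≤ (n≤1+n h) (⌈n/2⌉≤1+⌊n/2⌋ len))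

  H≤len : H ≤ len
  H≤len = ⌊n/2⌋<n len′

  due : Job → ℕ
  due j = dl j ∸ act

  open EDF due using (upTo)

  isShort : Job → Bool
  isShort j = due j ≤ᵇ rel j + h

  shortArrivals longArrivals : List Job → ℕ → ℕ → ℕ
  shortArrivals I s d = arrivals (λ j → isShort j ∧ upTo d j) I s
  longArrivals  I s d = arrivals (λ j → not (isShort j) ∧ upTo d j) I s

  shortOpenings longOpenings openings : List Job → ℕ → ℕ
  shortOpenings I = Short.openings h len′ (shortArrivals I)
  longOpenings  I = Long.openings h (longArrivals I)
  openings  I t   = shortOpenings I t + longOpenings I t

  openings-view : ∀ I {t s} → s ≤ t → openings (view t I) s ≡ openings I s
  openings-view I {t} {s} s≤t = cong₂ _+_
    (Short.openings-cong h len′ {shortArrivals (view t I)} {shortArrivals I} (suc t)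
      (λ u d u<1+t → arrivals-view (λ j → isShort j ∧ upTo d j) (≤-pred u<1+t) I) s (s≤s s≤t))
    (Long.openings-cong h {longArrivals (view t I)} {longArrivals I} (suc t)
      (λ u d u<1+t → arrivals-view (λ j → not (isShort j) ∧ upTo d j) (≤-pred u<1+t) I) s (s≤s s≤t))

  open Online act len openings openings-view public using (alg; algCal≡; capacity; due-valid) renaming (feasible to feasible-if)

  shortArrivals-valid : ∀ {I} → ValidInstance act I → ∀ s → shortArrivals I s s ≡ 0
  shortArrivals-valid                     []              s = refl
  shortArrivals-valid {j ∷ I} (valid ∷ valids) s = cong₂ _+_
    (𝟙-false {(isShort j ∧ upTo s j) ∧ (rel j ≡ᵇ s)} λ e →
      let (e₁ , e₂) = T-∧-elim {isShort j ∧ upTo s j} e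
          (_ , e₃)  = T-∧-elim {isShort j} e₁
      in <⇒≱ (due-valid {j} valid) (≤-trans (≤ᵇ⇒≤ (due j) s e₃) (≤-reflexive (sym (≡ᵇ⇒≡ (rel j) s e₂)))))
    (shortArrivals-valid valids s)

  shortArrivals-short : ∀ I s d → shortArrivals I s d ≤ shortArrivals I s (s + h)
  shortArrivals-short I s d = sumL-≤ (λ j → 𝟙-mono {(isShort j ∧ upTo d j) ∧ (rel j ≡ᵇ s)} λ e →
    let (e₁ , e₂) = T-∧-elim {isShort j ∧ upTo d j} e
        (e₃ , _)  = T-∧-elim {isShort j} e₁
    in T-∧-intro (T-∧-intro e₃ (subst (λ r → T (due j ≤ᵇ r + h)) (≡ᵇ⇒≡ (rel j) s e₂) e₃)) e₂) I

  shortArrivals-mono : ∀ I s {d d′} → d ≤ d′ → shortArrivals I s d ≤ shortArrivals I s d′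
  shortArrivals-mono I s {d} d≤d′ = arrivals-mono (λ j e →
    let (e₁ , e₂) = T-∧-elim {isShort j} e
    in T-∧-intro e₁ (≤⇒≤ᵇ (≤-trans (≤ᵇ⇒≤ (due j) d e₂) d≤d′))) I s

  longArrivals-late : ∀ I s d → d < s + H → longArrivals I s d ≡ 0
  longArrivals-late I s d d<s+H = trans (sumL-cong (λ j → 𝟙-false {(not (isShort j) ∧ upTo d j) ∧ (rel j ≡ᵇ s)} (none j)) I) (sumL-zero I)
    where
    none : ∀ j → ¬ T ((not (isShort j) ∧ upTo d j) ∧ (rel j ≡ᵇ s))
    none j e with isShort j in long
    ... | false = subst T long (≤⇒≤ᵇ (≤-trans (≤ᵇ⇒≤ (due j) d (proj₁ (T-∧-elim {upTo d j} e)))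
      (≤-pred (≤-trans d<s+H (≤-reflexive (trans (+-suc s h) (cong (λ r → suc (r + h)) (sym (≡ᵇ⇒≡ (rel j) s (proj₂ (T-∧-elim {upTo d j} e))))))))))) 

  arrivals-split : ∀ I s d → arrivals (upTo d) I s ≡ shortArrivals I s d + longArrivals I s d
  arrivals-split I s d = trans (sumL-cong split I) (sumL-+ _ _ I)
    where
    split : ∀ j → 𝟙 (upTo d j ∧ (rel j ≡ᵇ s)) ≡ 𝟙 ((isShort j ∧ upTo d j) ∧ (rel j ≡ᵇ s)) + 𝟙 ((not (isShort j) ∧ upTo d j) ∧ (rel j ≡ᵇ s))
    split j with isShort j
    ... | true  = sym (+-identityʳ _)
    ... | false = refl

  hall : ∀ {I} → ValidInstance act I → ∀ d → Hall (capacity I) (arrivals (upTo d) I) d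
  hall {I} valid d t₀ n eq = begin
    sumTo (λ i → arrivals (upTo d) I (t₀ + i)) n
      ≡⟨ sumTo-cong n (λ i _ → arrivals-split I (t₀ + i) d) ⟩
    sumTo (λ i → shortArrivals I (t₀ + i) d + longArrivals I (t₀ + i) d) n
      ≤⟨ Hall-+ {active (shortOpenings I) len} {active (longOpenings I) H} {λ s → shortArrivals I s d} {λ s → longArrivals I s d}
           (Short.feasible h len′ (shortArrivals I) (shortOpenings I) (Short.openings-unfold h len′ (shortArrivals I))
             (shortArrivals-mono I) (shortArrivals-short I) (shortArrivals-valid valid) d)
           (Long.feasible h (longArrivals I) (longOpenings I) (Long.openings-unfold h (longArrivals I)) (longArrivals-late I) d)
           t₀ n eq ⟩
    sumTo (λ i → active (shortOpenings I) len (t₀ + i) + active (longOpenings I) H (t₀ + i)) n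
      -- The long plan counts on `H` slots of calibrations that really have `len`.
      ≤⟨ sumTo-mono n (λ i _ → +-monoʳ-≤ (active (shortOpenings I) len (t₀ + i)) (window-mono (longOpenings I) (suc (t₀ + i)) H≤len)) ⟩
    sumTo (λ i → active (shortOpenings I) len (t₀ + i) + active (longOpenings I) len (t₀ + i)) n
      ≡⟨ sumTo-cong n (λ i _ → window-+ (shortOpenings I) (longOpenings I) len (suc (t₀ + i))) ⟨
    sumTo (λ i → capacity I (t₀ + i)) n ∎
    where open ≤-Reasoning

  feasible : ∀ I → ValidInstance act I → AlgFeasible act len alg I
  feasible I valid = feasible-if I valid (hall valid)

-- Comparison with an offline schedule

sumL-map : ∀ {X Y : Set} (f : Y → ℕ) (g : X → Y) xs → sumL f (map g xs) ≡ sumL (f ∘ g) xs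
sumL-map f g []       = refl
sumL-map f g (x ∷ xs) = cong (f (g x) +_) (sumL-map f g xs)

module _ {X : Set} where

  sumL-++ : ∀ (f : X → ℕ) xs ys → sumL f (xs ++ ys) ≡ sumL f xs + sumL f ys
  sumL-++ f []       ys = refl
  sumL-++ f (x ∷ xs) ys = trans (cong (f x +_) (sumL-++ f xs ys)) (sym (+-assoc (f x) _ _))

  sumL-≥ : ∀ (f : X → ℕ) {x xs} → x ∈ xs → f x ≤ sumL f xs
  sumL-≥ f (here refl)      = m≤m+n _ _
  sumL-≥ f (there {x = y} x∈xs) = ≤-trans (sumL-≥ f x∈xs) (m≤n+m _ (f y))

  sumL-positive : ∀ (f : X → ℕ) xs → 1 ≤ sumL f xs → ∃ λ x → x ∈ xs × 1 ≤ f x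
  sumL-positive f (x ∷ xs) pos with f x ≟ 0
  ... | no  f≢0 = x , here refl , n≢0⇒n>0 f≢0
  ... | yes f≡0 with sumL-positive f xs (subst (λ y → 1 ≤ y + sumL f xs) f≡0 pos)
  ...   | y , y∈xs , pos′ = y , there y∈xs , pos′

  sumL-if : ∀ b (f : X → ℕ) xs → (if b then sumL f xs else 0) ≡ sumL (λ x → if b then f x else 0) xs
  sumL-if true  f xs = refl
  sumL-if false f xs = sym (sumL-zero xs)

  -- Double counting: at most `g s` items sit at `s`, each of weight `w s`. Items at or beyond the
  -- cut-off `B` must weigh nothing.
  volume : ∀ (y : X → ℕ) (w g : ℕ → ℕ) xs B →
    (∀ s → sumL (λ x → 𝟙 (y x ≡ᵇ s)) xs ≤ g s) →
    All (λ x → y x < B ⊎ w (y x) ≡ 0) xs →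
    sumL (w ∘ y) xs ≤ sumTo (λ s → w s * g s) B
  volume y w g xs B cap inside = begin
    sumL (w ∘ y) xs                                                 ≤⟨ sumL-mono (All.map placed inside) ⟩
    sumL (λ x → sumTo (λ s → w s * 𝟙 (y x ≡ᵇ s)) B) xs              ≡⟨ sumTo-sumL (λ s x → w s * 𝟙 (y x ≡ᵇ s)) xs B ⟨
    sumTo (λ s → sumL (λ x → w s * 𝟙 (y x ≡ᵇ s)) xs) B              ≡⟨ sumTo-cong B (λ s _ → sumL-*ˡ (w s) (λ x → 𝟙 (y x ≡ᵇ s)) xs) ⟩
    sumTo (λ s → w s * sumL (λ x → 𝟙 (y x ≡ᵇ s)) xs) B              ≤⟨ sumTo-mono B (λ s _ → *-monoʳ-≤ (w s) (cap s)) ⟩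
    sumTo (λ s → w s * g s) B                                       ∎
    where
    open ≤-Reasoning
    placed : ∀ {x} → y x < B ⊎ w (y x) ≡ 0 → w (y x) ≤ sumTo (λ s → w s * 𝟙 (y x ≡ᵇ s)) B
    placed     (inj₂ none) = ≤-trans (≤-reflexive none) z≤n
    placed {x} (inj₁ y<B)  = ≤-trans (≤-reflexive (sym (*-identityˡ _)))
      (sumTo-block≤ (w (y x)) (λ s → w s * 𝟙 (y x ≡ᵇ s)) (y x) 1 (≤-trans (≤-reflexive (+-comm (y x) 1)) y<B) here-only)
      where
      here-only : ∀ i → i < 1 → w (y x) ≤ w (y x + i) * 𝟙 (y x ≡ᵇ y x + i)
      here-only zero _ rewrite +-identityʳ (y x) | Equivalence.to T-≡ (≡⇒≡ᵇ (y x) (y x) refl) = ≤-reflexive (sym (*-identityʳ _))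
      here-only (suc i) (s≤s ())

attach : (I : List Job) → (Fin (length I) → ℕ) → List (Job × ℕ)
attach []      time = []
attach (j ∷ I) time = (j , time zero) ∷ attach I (time ∘ suc)

attach-sumL : ∀ f I time → sumL (f ∘ proj₁) (attach I time) ≡ sumL f I
attach-sumL f []      time = refl
attach-sumL f (j ∷ I) time = cong (f j +_) (attach-sumL f I (time ∘ suc))

attach-All : ∀ {P : Job → ℕ → Set} I time → (∀ i → P (lookup I i) (time i)) → All (λ p → P (proj₁ p) (proj₂ p)) (attach I time)
attach-All []      time hyp = []
attach-All (j ∷ I) time hyp = hyp zero ∷ attach-All I (time ∘ suc) (hyp ∘ suc)

attach-#true : ∀ (q : ℕ → Bool) I time → #true (length I) (q ∘ time) ≡ sumL (λ p → 𝟙 (q (proj₂ p))) (attach I time)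
attach-#true q []      time = refl
attach-#true q (j ∷ I) time = cong (𝟙 (q (time zero)) +_) (attach-#true q I (time ∘ suc))

countList-sumL : ∀ p cs → countList p cs ≡ sumL (λ c → 𝟙 (p c)) cs
countList-sumL p []       = refl
countList-sumL p (c ∷ cs) = cong (𝟙 (p c) +_) (countList-sumL p cs)

calibrated-elim : ∀ act len c t → T (calibratedAt act len c t) → c + act ≤ t × t < c + act + len
calibrated-elim act len c t e = let (l , r) = T-∧-elim e in ≤ᵇ⇒≤ (c + act) t l , <ᵇ⇒< t (c + act + len) r

module Competitive (act len′ : ℕ) (I : List Job) (valid : ValidInstance act I)
                   (cals : List ℕ) (time : Fin (length I) → ℕ) (off : OffFeasible act (suc len′) I cals time) where

  open Algorithm act len′
  open Short h len′ using (len; centred; touches)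
  open Long h using (H)
  open EDF due using (upTo)

  k : ℕ
  k = length cals

  sched : List (Job × ℕ)
  sched = attach I time

  slots : ℕ → ℕ
  slots t = sumL (λ c → 𝟙 (calibratedAt act len c t)) cals

  sched-capacity : ∀ t → sumL (λ p → 𝟙 (proj₂ p ≡ᵇ t)) sched ≤ slots t
  sched-capacity t = subst₂ _≤_ (attach-#true (_≡ᵇ t) I time) (countList-sumL (λ s → calibratedAt act len s t) cals) (proj₂ off t)

  Feasible : Job × ℕ → Set
  Feasible (j , x) = (rel j ≤ x × x < dl j) × rel j < due j

  sched-feasible : All Feasible sched
  sched-feasible = attach-All {λ j x → (rel j ≤ x × x < dl j) × rel j < due j} I time λ i →
    (proj₁ (proj₁ off i) , ≤-trans (≤-reflexive (+-comm 1 (time i))) (proj₂ (proj₁ off i))) ,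
    due-valid {lookup I i} (All.lookup valid (∈-lookup i))

  sched-slot : ∀ {p} → p ∈ sched → ∃ λ c → c ∈ cals × c + act ≤ proj₂ p × proj₂ p < c + act + len
  sched-slot {j , x} p∈ with sumL-positive (λ c → 𝟙 (calibratedAt act len c x)) cals (≤-trans
    (≤-trans (≤-reflexive (sym (𝟙-true (≡⇒≡ᵇ x x refl)))) (sumL-≥ (λ p → 𝟙 (proj₂ p ≡ᵇ x)) p∈)) (sched-capacity x))
  ... | c , c∈ , pos = c , c∈ , calibrated-elim act len c x (positive pos)
    where
    positive : ∀ {b} → 1 ≤ 𝟙 b → T b
    positive {true} _ = _

  slots-total : ∀ B → sumTo slots B ≤ k * len
  slots-total B = begin
    sumTo slots B                                                            ≡⟨ sumTo-sumL (λ t c → 𝟙 (calibratedAt act len c t)) cals B ⟩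
    sumL (λ c → sumTo (λ t → 𝟙 (calibratedAt act len c t)) B) cals           ≤⟨ sumL-≤ (λ c → ≤-trans (sumTo-mono B (λ t _ → same c t)) (sumTo-interval (c + act) 0 len B)) cals ⟩
    sumL (λ _ → len) cals                                                    ≡⟨ sumL-const len cals ⟩
    k * len                                                                  ∎
    where
    open ≤-Reasoning
    same : ∀ c t → 𝟙 (calibratedAt act len c t) ≤ 𝟙 (interval (c + act) 0 len t)
    same c t = 𝟙-mono {calibratedAt act len c t} λ e → let (l , r) = calibrated-elim act len c t e in
      interval-intro {c + act} {0} (≤-trans l (≤-reflexive (sym (+-identityʳ t)))) r

  total : ℕ → ℕ
  total = arrivals (λ _ → true) I

  total≤ : ∀ n → sumTo total n ≤ k * len
  total≤ n = begin
    sumTo total n                                                  ≡⟨ sumTo-sumL (λ s j → 𝟙 (rel j ≡ᵇ s)) I n ⟩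
    sumL (λ j → sumTo (λ s → 𝟙 (rel j ≡ᵇ s)) n) I                  ≤⟨ sumL-≤ (λ j → sumTo-point (rel j) n) I ⟩
    sumL (λ _ → 1) I                                               ≡⟨ attach-sumL (λ _ → 1) I time ⟨
    sumL (λ _ → 1) sched                                           ≤⟨ volume proj₂ (λ _ → 1) slots sched B sched-capacity (All.tabulate λ p∈ → inj₁ (s≤s (sumL-≥ proj₂ p∈))) ⟩
    sumTo (λ s → 1 * slots s) B                                    ≡⟨ sumTo-cong B (λ s _ → *-identityˡ (slots s)) ⟩
    sumTo slots B                                                  ≤⟨ slots-total B ⟩
    k * len                                                        ∎
    where
    open ≤-Reasoning
    B = suc (sumL proj₂ sched)

  long≤total : ∀ s d → longArrivals I s d ≤ total s
  long≤total s d = arrivals-mono {q = λ _ → true} (λ _ _ → _) I s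

  -- At most `3H + len + act` times per calibration, hence at most `(5 + act) * H`. The work itself
  -- adds `len ≤ 2H`, which makes `7 + act`.
  near : ℕ → ℕ
  near t = sumL (λ c → 𝟙 (interval c (H + H) (len + (H + act)) t)) cals

  near-total : ∀ n → sumTo near n ≤ k * (H + H + (len + (H + act)))
  near-total n = begin
    sumTo near n                                                                       ≡⟨ sumTo-sumL (λ t c → 𝟙 (interval c (H + H) (len + (H + act)) t)) cals n ⟩
    sumL (λ c → sumTo (λ t → 𝟙 (interval c (H + H) (len + (H + act)) t)) n) cals       ≤⟨ sumL-≤ (λ c → sumTo-interval c (H + H) (len + (H + act)) n) cals ⟩
    sumL (λ _ → H + H + (len + (H + act))) cals                                        ≡⟨ sumL-const _ cals ⟩
    k * (H + H + (len + (H + act)))                                                    ∎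
    where open ≤-Reasoning

  ≤∸+ : ∀ m n → m ≤ m ∸ n + n
  ≤∸+ m n = ≤-trans (m≤n+m∸n m n) (≤-reflexive (+-comm n (m ∸ n)))

  -- The offline schedule runs the late job after `z` in some calibration `c`, and less than `H`
  -- after `m + z` once `act` is subtracted. So `m ⊓ H` consecutive times from `z` on are near `c`.
  cover : ∀ z m s → z < s → s ≤ m + z → 1 ≤ longArrivals I s (m + z + H) →
    m ⊓ H ≤ sumTo (λ i → near (z + i)) m
  cover z m s after _ pos
    with sumL-positive (λ p → 𝟙 ((not (isShort (proj₁ p)) ∧ upTo (m + z + H) (proj₁ p)) ∧ (rel (proj₁ p) ≡ᵇ s))) sched
           (≤-trans pos (≤-reflexive (sym (attach-sumL (λ j → 𝟙 ((not (isShort j) ∧ upTo (m + z + H) j) ∧ (rel j ≡ᵇ s))) I time))))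
  ... | (j , x) , p∈ , pos′ = ≤-trans (≤-reflexive (sym (*-identityʳ (m ⊓ H))))
        (sumTo-block≤ 1 (λ i → near (z + i)) e (m ⊓ H) e+m≤ covered)
    where
    arrival : rel j ≡ s × due j ≤ m + z + H
    arrival with ((not (isShort j) ∧ upTo (m + z + H) j) ∧ (rel j ≡ᵇ s)) in eq
    ... | true with T-∧-elim {not (isShort j) ∧ upTo (m + z + H) j} (subst T (sym eq) _)
    ...   | e₁ , e₂ = ≡ᵇ⇒≡ (rel j) s e₂ , ≤ᵇ⇒≤ (due j) _ (proj₂ (T-∧-elim {not (isShort j)} e₁))
    arrival | false = contradiction pos′ λ()

    c = proj₁ (sched-slot p∈)
    c∈ = proj₁ (proj₂ (sched-slot p∈))
    c≤x = proj₁ (proj₂ (proj₂ (sched-slot p∈)))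
    x<c = proj₂ (proj₂ (proj₂ (sched-slot p∈)))
    window-p = proj₁ (All.lookup sched-feasible p∈)

    y = x ∸ act
    act≤x : act ≤ x
    act≤x = ≤-trans (m≤n+m act c) c≤x
    y+act : y + act ≡ x
    y+act = m∸n+n≡m act≤x
    c≤y : c ≤ y
    c≤y = m+n≤o⇒m≤o∸n c c≤x
    z<y+act : z < y + act
    z<y+act = <-≤-trans after (≤-trans (≤-reflexive (sym (proj₁ arrival))) (≤-trans (proj₁ window-p) (≤-reflexive (sym y+act))))
    y<due : y < m + z + H
    y<due = <-≤-trans (∸-monoˡ-< (proj₂ window-p) act≤x) (proj₂ arrival)

    -- The block starts at `z`, or `2H` before `y` if that is later; `y < m + z + H` leaves room for
    -- it.
    e = y ∸ (H + H + z)

    e+m≤ : e + m ⊓ H ≤ m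
    e+m≤ with ≤-total y (H + H + z)
    ... | inj₁ early rewrite m≤n⇒m∸n≡0 early = m⊓n≤m m H
    ... | inj₂ late  = ≤-linear 1 (+-mono-≤ (+-mono-≤ y<due (m⊓n≤n m H)) (≤-reflexive (m∸n+n≡m late))) (eq e (m ⊓ H) m z H y)
      where
      eq : ∀ e g m z h y → e + g + (m + z + h + h + y) + 1 ≡ suc y + g + (e + (h + h + z)) + m
      eq = solve-∀

    covered : ∀ i → i < m ⊓ H → 1 ≤ near (z + (e + i))
    covered i i< = ≤-trans (≤-reflexive (sym (𝟙-true (interval-intro {c} {H + H} {len + (H + act)} from until)))) (sumL-≥ _ c∈)
      where
      i<H = <-≤-trans i< (m⊓n≤n m H)
      from : c ≤ z + (e + i) + (H + H)
      from = ≤-linear i (+-mono-≤ c≤y (≤∸+ y (H + H + z))) (eq c y e z i H)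
        where
        eq : ∀ c y e z i h → c + (y + (e + (h + h + z))) + i ≡ c + y + (z + (e + i) + (h + h))
        eq = solve-∀
      before-end : z + (e + i) < y + act + H
      before-end with ≤-total y (H + H + z)
      ... | inj₁ early rewrite m≤n⇒m∸n≡0 early = +-mono-< z<y+act i<H
      ... | inj₂ late = ≤-linear (act + H + H) (+-mono-≤ (≤-reflexive (m∸n+n≡m late)) i<H) (eq z e i y act H)
        where
        eq : ∀ z e i y a h → suc (z + (e + i)) + (y + h) + (a + h + h) ≡ e + (h + h + z) + suc i + (y + a + h)
        eq = solve-∀
      until : z + (e + i) < c + (len + (H + act))
      until = ≤-linear 1 (+-mono-≤ before-end (+-mono-≤ x<c (≤-reflexive y+act))) (eq (z + (e + i)) c y act len′ H x)
        where
        eq : ∀ t c y a l h x → suc t + (y + a + h + (c + a + suc l + x)) + 1 ≡ suc t + (suc x + (y + a)) + (c + (suc l + (h + a)))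
        eq = solve-∀

  long-cost : ∀ n → sumTo (longOpenings I) n ≤ (7 + act) * k + 1
  long-cost n = *-cancelˡ-≤ H (begin
    H * sumTo (longOpenings I) n
      ≤⟨ Long.cost h (longArrivals I) (longOpenings I) (Long.openings-unfold h (longArrivals I)) total near long≤total cover n ⟩
    sumTo total n + H + sumTo near n
      ≤⟨ +-mono-≤ (+-monoˡ-≤ H (total≤ n)) (near-total n) ⟩
    k * len + H + k * (H + H + (len + (H + act)))
      ≤⟨ +-mono-≤ (+-monoˡ-≤ H (*-monoʳ-≤ k len≤H+H)) (*-monoʳ-≤ k (+-monoʳ-≤ (H + H) (+-mono-≤ len≤H+H (+-monoʳ-≤ H (m≤n*m act H))))) ⟩
    k * (H + H) + H + k * (H + H + (H + H + (H + H * act)))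
      ≡⟨ eq k H act ⟩
    H * ((7 + act) * k + 1) ∎)
    where
    open ≤-Reasoning
    eq : ∀ k h a → k * (h + h) + h + k * (h + h + (h + h + (h + h * a))) ≡ h * ((7 + a) * k + 1)
    eq = solve-∀

  -- Delaying every job executed before rel + act until rel + act gives a schedule
  -- for the shrunk windows; its delays are at most act, so it fits into the
  -- copies of the calibrations shifted by 0, …, act.

  shifts : ℕ → List ℕ
  shifts zero    = []
  shifts (suc n) = shifts n ++ map (n +_) cals

  shifts-sumL : ∀ f n → sumL f (shifts n) ≡ sumTo (λ δ → sumL (λ c → f (δ + c)) cals) n
  shifts-sumL f zero    = refl
  shifts-sumL f (suc n) = trans (sumL-++ f (shifts n) _) (cong₂ _+_ (shifts-sumL f n) (sumL-map f (n +_) cals))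

  shifts-length : ∀ n → length (shifts n) ≡ n * k
  shifts-length zero    = refl
  shifts-length (suc n) = trans (length-++ (shifts n)) (trans (cong₂ _+_ (shifts-length n) (length-map (n +_) cals)) (+-comm (n * k) k))

  delayed : Job × ℕ → ℕ
  delayed (j , x) = (x ∸ act) ⊔ rel j

  cs : List ℕ
  cs = shifts (suc act)

  delayed-capacity : ∀ y → sumL (λ p → 𝟙 (delayed p ≡ᵇ y)) sched ≤ sumL (λ c → 𝟙 (interval c 0 len y)) cs
  delayed-capacity y = begin
    sumL (λ p → 𝟙 (delayed p ≡ᵇ y)) sched
      ≤⟨ sumL-mono (All.tabulate original) ⟩
    sumL (λ p → sumTo (λ δ → 𝟙 (proj₂ p ≡ᵇ y + act ∸ δ)) (suc act)) sched
      ≡⟨ sumTo-sumL (λ δ p → 𝟙 (proj₂ p ≡ᵇ y + act ∸ δ)) sched (suc act) ⟨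
    sumTo (λ δ → sumL (λ p → 𝟙 (proj₂ p ≡ᵇ y + act ∸ δ)) sched) (suc act)
      ≤⟨ sumTo-mono (suc act) (λ δ δ≤ → ≤-trans (sched-capacity (y + act ∸ δ)) (sumL-≤ (λ c → shifted δ c (≤-pred δ≤)) cals)) ⟩
    sumTo (λ δ → sumL (λ c → 𝟙 (interval (δ + c) 0 len y)) cals) (suc act)
      ≡⟨ shifts-sumL (λ c → 𝟙 (interval c 0 len y)) (suc act) ⟨
    sumL (λ c → 𝟙 (interval c 0 len y)) cs ∎
    where
    open ≤-Reasoning
    shifted : ∀ δ c → δ ≤ act → 𝟙 (calibratedAt act len c (y + act ∸ δ)) ≤ 𝟙 (interval (δ + c) 0 len y)
    shifted δ c δ≤act = 𝟙-mono {calibratedAt act len c (y + act ∸ δ)} λ e →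
      let (l , r) = calibrated-elim act len c (y + act ∸ δ) e in
      interval-intro {δ + c} {0} {len}
        (≤-linear 0 (m≤o∸n⇒m+n≤o (c + act) δ≤ l) (eq₁ δ c act y))
        (≤-linear 0 (+-mono-≤ r (≤∸+ (y + act) δ)) (eq₂ y (y + act ∸ δ) δ c act len′))
      where
      δ≤ : δ ≤ y + act
      δ≤ = ≤-trans δ≤act (m≤n+m act y)
      eq₁ : ∀ δ c a y → δ + c + (y + a) + 0 ≡ c + a + δ + (y + 0)
      eq₁ = solve-∀
      eq₂ : ∀ y x δ c a l → suc y + (c + a + suc l + (x + δ)) + 0 ≡ suc x + (y + a) + (δ + c + suc l)
      eq₂ = solve-∀
    original : ∀ {p} → p ∈ sched → 𝟙 (delayed p ≡ᵇ y) ≤ sumTo (λ δ → 𝟙 (proj₂ p ≡ᵇ y + act ∸ δ)) (suc act)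
    original {j , x} p∈ with delayed (j , x) ≡ᵇ y in eq
    ... | false = z≤n
    -- The witness is the delay `y ∸ x̃`, at most `act` since the job was released by `x`.
    ... | true  = sumTo-block≤ 1 (λ δ → 𝟙 (x ≡ᵇ y + act ∸ δ)) (y ∸ x̃) 1 inside here-only
      where
      x̃ = x ∸ act
      x̃+act : x̃ + act ≡ x
      x̃+act = m∸n+n≡m (≤-trans (m≤n+m act (proj₁ (sched-slot p∈))) (proj₁ (proj₂ (proj₂ (sched-slot p∈)))))
      y≡ : x̃ ⊔ rel j ≡ y
      y≡ = ≡ᵇ⇒≡ (x̃ ⊔ rel j) y (subst T (sym eq) _)
      x̃≤y : x̃ ≤ y
      x̃≤y = ≤-trans (m≤m⊔n x̃ (rel j)) (≤-reflexive y≡)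
      y≤ : y ≤ x̃ + act
      y≤ = ≤-trans (≤-reflexive (sym y≡)) (⊔-lub (m≤m+n x̃ act)
        (≤-trans (proj₁ (proj₁ (All.lookup sched-feasible p∈))) (≤-reflexive (sym x̃+act))))
      inside : y ∸ x̃ + 1 ≤ suc act
      inside = ≤-trans (≤-reflexive (+-comm _ 1)) (s≤s (m≤n+o⇒m∸n≤o y x̃ y≤))
      here-only : ∀ i → i < 1 → 1 ≤ 𝟙 (x ≡ᵇ y + act ∸ (y ∸ x̃ + i))
      here-only zero _ = ≤-reflexive (sym (𝟙-true (≡⇒≡ᵇ x _ (sym back))))
        where
        back : y + act ∸ (y ∸ x̃ + 0) ≡ x
        back = trans (cong (y + act ∸_) (+-identityʳ (y ∸ x̃))) (trans (+-∸-comm act (m∸n≤m y x̃))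
          (trans (cong (_+ act) (m∸[m∸n]≡n x̃≤y)) x̃+act))
      here-only (suc i) (s≤s ())

  module _ (t u : ℕ) (u≤h : u ≤ h) where

    private
      counted : Job × ℕ → ℕ → ℕ
      counted (j , x) s = if t ≤ᵇ s + u then 𝟙 ((isShort j ∧ upTo (t + u) j) ∧ (rel j ≡ᵇ s)) else 0

    -- A counted job has its shrunk window inside [t - u, t + u), and its delayed slot lies in that
    -- window. The single release time makes the sum at most one.
    counted≤ : ∀ {p} → Feasible p → sumTo (counted p) (suc t) ≤ 𝟙 (interval t u u (delayed p))
    counted≤ {j , x} ((rel≤x , x<dl) , rel<due) = begin
      sumTo (counted (j , x)) (suc t)                                           ≤⟨ sumTo-mono (suc t) (λ s _ → term s) ⟩
      sumTo (λ s → 𝟙 (interval t u u (delayed (j , x))) * 𝟙 (rel j ≡ᵇ s)) (suc t) ≡⟨ sumTo-*ˡ (𝟙 (interval t u u (delayed (j , x)))) _ (suc t) ⟩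
      𝟙 (interval t u u (delayed (j , x))) * sumTo (λ s → 𝟙 (rel j ≡ᵇ s)) (suc t) ≤⟨ *-monoʳ-≤ (𝟙 (interval t u u (delayed (j , x)))) (sumTo-point (rel j) (suc t)) ⟩
      𝟙 (interval t u u (delayed (j , x))) * 1                                  ≡⟨ *-identityʳ _ ⟩
      𝟙 (interval t u u (delayed (j , x)))                                      ∎
      where
      open ≤-Reasoning
      delayed<due : (x ∸ act) ⊔ rel j < due j
      delayed<due = ⊔-lub (x∸act<) rel<due
        where
        x∸act< : x ∸ act < due j
        x∸act< with act ≤? x
        ... | yes act≤x = ∸-monoˡ-< x<dl act≤x
        ... | no  act≰x = ≤-<-trans (≤-trans (≤-reflexive (m≤n⇒m∸n≡0 (<⇒≤ (≰⇒> act≰x)))) z≤n) rel<due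
      term : ∀ s → counted (j , x) s ≤ 𝟙 (interval t u u (delayed (j , x))) * 𝟙 (rel j ≡ᵇ s)
      term s with t ≤ᵇ s + u in t≤
      ... | false = z≤n
      ... | true with ((isShort j ∧ upTo (t + u) j) ∧ (rel j ≡ᵇ s)) in eq
      ...   | false = z≤n
      ...   | true with T-∧-elim {isShort j ∧ upTo (t + u) j} (subst T (sym eq) _)
      ...     | e₁ , e₂ = ≤-reflexive (sym (cong₂ _*_ (𝟙-true {interval t u u (delayed (j , x))} (interval-intro {t} {u} {u}
        (≤-trans (≤ᵇ⇒≤ t (s + u) (subst T (sym t≤) _)) (+-monoˡ-≤ u (≤-trans (≤-reflexive (sym (≡ᵇ⇒≡ (rel j) s e₂))) (m≤n⊔m (x ∸ act) (rel j)))))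
        (<-≤-trans delayed<due (≤ᵇ⇒≤ (due j) (t + u) (proj₂ (T-∧-elim {isShort j} e₁)))))) (𝟙-true {rel j ≡ᵇ s} e₂)))

    -- A touching copy offers at most `2u` slots in [t - u, t + u), any other copy none.
    centred≤ : centred (shortArrivals I) t u ≤ sumL (λ c → 𝟙 (touches t c)) cs * (u + u)
    centred≤ = begin
      centred (shortArrivals I) t u
        ≡⟨ sumTo-cong (suc t) (λ s _ → trans (cong (λ a → if t ≤ᵇ s + u then a else 0) (sym (attach-sumL _ I time))) (sumL-if (t ≤ᵇ s + u) _ sched)) ⟩
      sumTo (λ s → sumL (λ p → counted p s) sched) (suc t)
        ≡⟨ sumTo-sumL (λ s p → counted p s) sched (suc t) ⟩
      sumL (λ p → sumTo (counted p) (suc t)) sched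
        ≤⟨ sumL-mono (All.map counted≤ sched-feasible) ⟩
      sumL (λ p → 𝟙 (interval t u u (delayed p))) sched
        ≤⟨ volume delayed (λ y → 𝟙 (interval t u u y)) slots′ sched (t + u) delayed-capacity (All.tabulate λ {p} _ → early p) ⟩
      sumTo (λ y → 𝟙 (interval t u u y) * slots′ y) (t + u)
        ≡⟨ sumTo-cong (t + u) (λ y _ → sym (sumL-*ˡ (𝟙 (interval t u u y)) _ cs)) ⟩
      sumTo (λ y → sumL (λ c → 𝟙 (interval t u u y) * 𝟙 (interval c 0 len y)) cs) (t + u)
        ≡⟨ sumTo-sumL _ cs (t + u) ⟩
      sumL (λ c → sumTo (λ y → 𝟙 (interval t u u y) * 𝟙 (interval c 0 len y)) (t + u)) cs
        ≤⟨ sumL-≤ meets cs ⟩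
      sumL (λ c → (u + u) * 𝟙 (touches t c)) cs
        ≡⟨ sumL-*ˡ (u + u) _ cs ⟩
      (u + u) * sumL (λ c → 𝟙 (touches t c)) cs
        ≡⟨ *-comm (u + u) _ ⟩
      sumL (λ c → 𝟙 (touches t c)) cs * (u + u) ∎
      where
      open ≤-Reasoning
      slots′ : ℕ → ℕ
      slots′ y = sumL (λ c → 𝟙 (interval c 0 len y)) cs
      early : ∀ p → delayed p < t + u ⊎ 𝟙 (interval t u u (delayed p)) ≡ 0
      early p with delayed p <? t + u
      ... | yes y<  = inj₁ y<
      ... | no  y≮ = inj₂ (𝟙-false {interval t u u (delayed p)} λ e → y≮ (proj₂ (interval-elim t u u (delayed p) e)))
      meets : ∀ c → sumTo (λ y → 𝟙 (interval t u u y) * 𝟙 (interval c 0 len y)) (t + u) ≤ (u + u) * 𝟙 (touches t c)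
      meets c = begin
        sumTo (λ y → 𝟙 (interval t u u y) * 𝟙 (interval c 0 len y)) (t + u)    ≤⟨ sumTo-mono (t + u) (λ y _ → both y) ⟩
        sumTo (λ y → 𝟙 (touches t c) * 𝟙 (interval t u u y)) (t + u)               ≡⟨ sumTo-*ˡ (𝟙 (touches t c)) _ (t + u) ⟩
        𝟙 (touches t c) * sumTo (λ y → 𝟙 (interval t u u y)) (t + u)               ≤⟨ *-monoʳ-≤ (𝟙 (touches t c)) (sumTo-interval t u u (t + u)) ⟩
        𝟙 (touches t c) * (u + u)                                                  ≡⟨ *-comm (𝟙 (touches t c)) (u + u) ⟩
        (u + u) * 𝟙 (touches t c)                                                  ∎
        where
        both : ∀ y → 𝟙 (interval t u u y) * 𝟙 (interval c 0 len y) ≤ 𝟙 (touches t c) * 𝟙 (interval t u u y)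
        both y with interval t u u y in eq₁ | interval c 0 len y in eq₂
        ... | false | _     = z≤n
        ... | true  | false = z≤n
        ... | true  | true  with interval-elim t u u y (subst T (sym eq₁) _) | interval-elim c 0 len y (subst T (sym eq₂) _)
        ...   | t≤y+u , y<t+u | c≤y , y<c+len = ≤-reflexive (sym (cong (_* 1) (𝟙-true {touches t c} (T-∧-intro
          (<⇒<ᵇ (≤-<-trans (≤-trans c≤y (≤-reflexive (+-identityʳ y))) (<-≤-trans y<t+u (+-monoʳ-≤ t u≤h))))
          (<⇒<ᵇ (≤-<-trans t≤y+u (+-mono-<-≤ y<c+len u≤h)))))))

  short-cost : ∀ n → sumTo (shortOpenings I) n ≤ 8 * (suc act * k)
  short-cost n = ≤-trans
    (Short.cost h len′ (shortArrivals I) (shortOpenings I) (Short.openings-unfold h len′ (shortArrivals I)) h+h≤len cs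
      (λ t → Short.density-least h len′ (shortArrivals I) t λ u _ u≤h → centred≤ t u u≤h) n)
    (≤-reflexive (cong (8 *_) (shifts-length (suc act))))

  cost : ∀ n → sumTo (algCal alg I) n ≤ (9 * act + 15) * k + 1
  cost n = begin
    sumTo (algCal alg I) n                                  ≡⟨ sumTo-cong n (λ t _ → algCal≡ I t) ⟩
    sumTo (openings I) n                                    ≡⟨ sumTo-+ (shortOpenings I) (longOpenings I) n ⟩
    sumTo (shortOpenings I) n + sumTo (longOpenings I) n    ≤⟨ +-mono-≤ (short-cost n) (long-cost n) ⟩
    8 * (suc act * k) + ((7 + act) * k + 1)                 ≡⟨ eq act k ⟩
    (9 * act + 15) * k + 1                                  ∎
    where
    open ≤-Reasoning
    eq : ∀ a k → 8 * (suc a * k) + ((7 + a) * k + 1) ≡ (9 * a + 15) * k + 1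
    eq = solve-∀

-- Comparison of the constants with e

8fact≤3eNum : ∀ n → 8 * fact (3 + n) ≤ 3 * eNum (3 + n)
-- 1 + 1 + 1/2 + 1/6 is exactly 8/3.
8fact≤3eNum zero    = ≤-refl
8fact≤3eNum (suc n) = ≤-linear 3 (*-monoʳ-≤ (4 + n) (8fact≤3eNum n)) (eq (4 + n) (fact (3 + n)) (eNum (3 + n)))
  where
  eq : ∀ m f e → 8 * (m * f) + m * (3 * e) + 3 ≡ m * (8 * f) + 3 * (m * e + 1)
  eq = solve-∀

-- The first two partial sums, 2 and 5/2, are too small; there the correction term of the upper
-- bounds 3 and 11/4 is used.
8/3≤e : ∀ n → 8 * (fact (suc n) * suc n) ≤ 3 * (suc n * eNum (suc n) + 1)
8/3≤e zero          = ≤ᵇ⇒≤ 8 9 _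
8/3≤e (suc zero)    = ≤ᵇ⇒≤ 32 33 _
8/3≤e (suc (suc n)) = ≤-linear 3 (*-monoʳ-≤ (3 + n) (8fact≤3eNum n)) (eq (3 + n) (fact (3 + n)) (eNum (3 + n)))
  where
  eq : ∀ m f e → 8 * (f * m) + m * (3 * e) + 3 ≡ m * (8 * f) + 3 * (m * e + 1)
  eq = solve-∀

-- Beyond `3 * act + 7` there remains `6 * act + 8`, at most `8 * (act + 1)` and so at most
-- `3 * (act + 1)` times e.
compBound : ∀ act A k → A ≤ (9 * act + 15) * k + 1 → CompBound act A k 1
compBound act A k A≤ n = begin
  (A ∸ ((3 * act + 7) * k + 1)) * x       ≤⟨ *-monoˡ-≤ x excess ⟩
  8 * ((act + 1) * k) * x                 ≡⟨ eq₁ ((act + 1) * k) x ⟩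
  (act + 1) * k * (8 * x)                 ≤⟨ *-monoʳ-≤ ((act + 1) * k) (8/3≤e n) ⟩
  (act + 1) * k * (3 * y)                 ≡⟨ eq₂ act k y ⟩
  (3 * act + 3) * k * y                   ∎
  where
  open ≤-Reasoning
  x = fact (suc n) * suc n
  y = suc n * eNum (suc n) + 1
  eq : ∀ A a k → A + ((9 * a + 15) * k + 1) + 2 * (a * k) ≡ A + ((3 * a + 7) * k + 1 + 8 * ((a + 1) * k))
  eq = solve-∀
  excess : A ∸ ((3 * act + 7) * k + 1) ≤ 8 * ((act + 1) * k)
  excess = m≤n+o⇒m∸n≤o A ((3 * act + 7) * k + 1) (≤-linear (2 * (act * k)) A≤ (eq A act k))
  eq₁ : ∀ b x → 8 * b * x ≡ b * (8 * x)
  eq₁ = solve-∀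
  eq₂ : ∀ a k y → (a + 1) * k * (3 * y) ≡ (3 * a + 3) * k * y
  eq₂ = solve-∀

theorem3 : (act T : ℕ) → 1 ≤ T →
    Σ OnlineAlg (λ alg → Σ ℕ (λ a →
    (I : Instance) → ValidInstance act I →
    AlgFeasible act T alg I
    × ((cals : List ℕ) (time : Fin (length I) → ℕ) →
    OffFeasible act T I cals time →
    (H : ℕ) → CompBound act (sumTo (algCal alg I) H) (length cals) a)))
theorem3 act (suc len′) _ = Algorithm.alg act len′ , 1 , λ I valid →
  Algorithm.feasible act len′ I valid ,
  λ cals time off n → compBound act _ (length cals) (Competitive.cost act len′ I valid cals time off n)
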